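{- Fix positive integers $c$ and $N$. For $n\ge N+1$ let $p_{cn,N}(n)$ be the probability that a (uniformly random) $cn$-tuple of functions between $cn$ sets of cardinality $n$ is eventually $N$-cyclic. Then $$\lim_{n\to\infty}p_{cn,N}(n)=\frac1N\,e^{ -c\binom N2}\left(1-e^{ -cN}\right).$$
   Context: For a positive integer $k$ (here $k=cn$), a $k$-tuple of functions between $k$ pairwise disjoint sets $X_1,\dots,X_k$ of cardinality $n$ means $(f_1,\dots,f_k)$ with $f_i:X_i\to X_{i+1}$, indices modulo $k$ ($X_{k+1}=X_1$). There are $n^{kn}$ such tuples and $p_{k,N}(n)$ is the proportion that are eventually $N$-cyclic. The tuple is eventually $N$-cyclic if the iterated images $(f_k\cdots f_1)^m(X_1)$ eventually stabilize (for large $m$) to a subset of $X_1$ of cardinality $N$ on which $f_k\cdots f_1$ acts as an $N$-cycle (a single cyclic permutation of all $N$ elements). -}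

module Defs where

import Algebra.Definitions.RawSemiring
open import Data.Fin.Base using (Fin; toℕ; finToFun; funToFin)
open import Data.Fin.Properties using (_≟_; any?; all?; finToFun-funToFin)
open import Data.Fin.Subset using (Subset; _∈_; _⊆_; ∣_∣)
open import Data.Fin.Subset.Properties using (_∈?_; ⊆-antisym; p⊂q⇒∣p∣<∣q∣; ∣p∣≤n)
open import Data.Integer.Base as ℤ using (ℤ; +_)
import Data.Integer.Properties as ℤ
open import Data.List.Base using (List; []; _∷_; length; filter; allFin; cartesianProductWith)
open import Data.Nat.Base as ℕ using (ℕ; zero; suc; NonZero; z≤n; s≤s; _!)
open import Data.Nat.DivMod using (_mod_)
open import Data.Nat.GeneralisedArithmetic using (iterate)
import Data.Nat.Properties as ℕ
open import Data.Product.Base using (∃; ∃-syntax; _×_; _,_; proj₁; proj₂)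
open import Data.Rational.Base as ℚ using (ℚ; 0ℚ; 1ℚ; ½)
import Data.Rational.Properties as ℚ
import Data.Rational.Solver as ℚ
open import Data.Rational.Unnormalised.Base as ℚᵘ using (mkℚᵘ)
import Data.Rational.Unnormalised.Properties as ℚᵘ
open import Data.Sum.Base using (_⊎_; inj₁; inj₂)
open import Data.Vec.Base using (Vec; []; _∷_; lookup; tabulate)
open import Data.Vec.Properties using ([]=⇒lookup; lookup⇒[]=; lookup∘tabulate)
open import Function.Base using (_∘_)
open import Function.Bundles using (_⇔_; mk⇔; Equivalence)
open import Function.Definitions using (Injective)
open import Relation.Binary.PropositionalEquality
open import Relation.Nullary using (Dec; yes; no; does; contradiction; ¬?)
open import Relation.Nullary.Decidable using (map′; _×-dec_; _→-dec_; dec-true; decidable-stable)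

private
  variable
    k n : ℕ

Cauchy : (ℕ → ℚ) → Set
Cauchy a = ∀ ε → 0ℚ ℚ.< ε →
  ∃[ K ] ∀ m n → K ℕ.≤ m → K ℕ.≤ n → ℚ.∣ a m ℚ.- a n ∣ ℚ.< ε

open ℚ.+-*-Solver
open ℚ.≤-Reasoning

½-pos : ∀ {ε} → 0ℚ ℚ.< ε → 0ℚ ℚ.< ½ ℚ.* ε
½-pos {ε} 0<ε =
  ℚ.positive⁻¹ (½ ℚ.* ε) {{ℚ.pos*pos⇒pos ½ ε {{ℚ.positive 0<ε}}}}

½+½ : ∀ ε → ½ ℚ.* ε ℚ.+ ½ ℚ.* ε ≡ ε
½+½ = solve 1 (λ e → con ½ :* e :+ con ½ :* e := e) refl

½< : ∀ {ε} → 0ℚ ℚ.< ε → ½ ℚ.* ε ℚ.< ε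
½< {ε} 0<ε = begin-strict
  ½ ℚ.* ε                 ≡⟨ ℚ.+-identityʳ _ ⟨
  ½ ℚ.* ε ℚ.+ 0ℚ          <⟨ ℚ.+-monoʳ-< (½ ℚ.* ε) (½-pos 0<ε) ⟩
  ½ ℚ.* ε ℚ.+ ½ ℚ.* ε     ≡⟨ ½+½ ε ⟩
  ε                       ∎

Cauchy≤ : (ℕ → ℚ) → Set
Cauchy≤ a = ∀ ε → 0ℚ ℚ.< ε →
  ∃[ K ] ∀ m n → K ℕ.≤ m → K ℕ.≤ n → ℚ.∣ a m ℚ.- a n ∣ ℚ.≤ ε

fromCauchy≤ : ∀ {a} → Cauchy≤ a → Cauchy a
fromCauchy≤ h ε 0<ε with K , H ← h (½ ℚ.* ε) (½-pos 0<ε) =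
  K , λ m n p q → ℚ.≤-<-trans (H m n p q) (½< 0<ε)

∣-∣-comm : ∀ p q → ℚ.∣ p ℚ.- q ∣ ≡ ℚ.∣ q ℚ.- p ∣
∣-∣-comm p q = trans
  (sym (ℚ.∣-p∣≡∣p∣ (p ℚ.- q)))
  (cong ℚ.∣_∣ (solve 2 (λ p q → :- (p :- q) := q :- p) refl p q))

fromBase : ∀ {a} →
  (∀ ε → 0ℚ ℚ.< ε → ∃[ K ] ∀ n → K ℕ.≤ n → ℚ.∣ a n ℚ.- a K ∣ ℚ.≤ ε) →
  Cauchy a
fromBase {a} h = fromCauchy≤ {a} λ ε 0<ε →
  let K , H = h (½ ℚ.* ε) (½-pos 0<ε) in
  K , λ m n p q → begin
    ℚ.∣ a m ℚ.- a n ∣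
      ≡⟨ cong ℚ.∣_∣ (solve 3 (λ x y z → x :- y := (x :- z) :+ (z :- y)) refl (a m) (a n) (a K)) ⟩
    ℚ.∣ (a m ℚ.- a K) ℚ.+ (a K ℚ.- a n) ∣
      ≤⟨ ℚ.∣p+q∣≤∣p∣+∣q∣ (a m ℚ.- a K) (a K ℚ.- a n) ⟩
    ℚ.∣ a m ℚ.- a K ∣ ℚ.+ ℚ.∣ a K ℚ.- a n ∣
      ≡⟨ cong (ℚ.∣ a m ℚ.- a K ∣ ℚ.+_) (∣-∣-comm (a K) (a n)) ⟩
    ℚ.∣ a m ℚ.- a K ∣ ℚ.+ ℚ.∣ a n ℚ.- a K ∣
      ≤⟨ ℚ.+-mono-≤ (H m p) (H n q) ⟩
    ½ ℚ.* ε ℚ.+ ½ ℚ.* ε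
      ≡⟨ ½+½ ε ⟩
    ε ∎

cauchy-const : ∀ q → Cauchy (λ _ → q)
cauchy-const q ε 0<ε = 0 , λ _ _ _ _ →
  subst (ℚ._< ε) (cong ℚ.∣_∣ (sym (ℚ.+-inverseʳ q))) 0<ε

cauchy-neg : ∀ {a} → Cauchy a → Cauchy (λ n → ℚ.- a n)
cauchy-neg {a} h ε 0<ε with K , H ← h ε 0<ε =
  K , λ m n p q → subst (ℚ._< ε)
    (trans (sym (ℚ.∣-p∣≡∣p∣ (a m ℚ.- a n)))
      (cong ℚ.∣_∣ (solve 2 (λ x y → :- (x :- y) := (:- x) :- (:- y)) refl (a m) (a n))))
    (H m n p q)

cauchy-+ : ∀ {a b} → Cauchy a → Cauchy b → Cauchy (λ n → a n ℚ.+ b n)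
cauchy-+ {a} {b} h₁ h₂ ε 0<ε
  with K₁ , H₁ ← h₁ (½ ℚ.* ε) (½-pos 0<ε) | K₂ , H₂ ← h₂ (½ ℚ.* ε) (½-pos 0<ε) =
  K₁ ℕ.⊔ K₂ , λ m n p q → begin-strict
    ℚ.∣ (a m ℚ.+ b m) ℚ.- (a n ℚ.+ b n) ∣
      ≡⟨ cong ℚ.∣_∣ (solve 4 (λ x y z w → (x :+ y) :- (z :+ w) := (x :- z) :+ (y :- w)) refl (a m) (b m) (a n) (b n)) ⟩
    ℚ.∣ (a m ℚ.- a n) ℚ.+ (b m ℚ.- b n) ∣
      ≤⟨ ℚ.∣p+q∣≤∣p∣+∣q∣ (a m ℚ.- a n) (b m ℚ.- b n) ⟩
    ℚ.∣ a m ℚ.- a n ∣ ℚ.+ ℚ.∣ b m ℚ.- b n ∣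
      <⟨ ℚ.+-mono-< (H₁ m n (ℕ.m⊔n≤o⇒m≤o K₁ K₂ p) (ℕ.m⊔n≤o⇒m≤o K₁ K₂ q))
                    (H₂ m n (ℕ.m⊔n≤o⇒n≤o K₁ K₂ p) (ℕ.m⊔n≤o⇒n≤o K₁ K₂ q)) ⟩
    ½ ℚ.* ε ℚ.+ ½ ℚ.* ε
      ≡⟨ ½+½ ε ⟩
    ε ∎

∣∣-≤-∣-∣ : ∀ p q → ℚ.∣ p ∣ ℚ.- ℚ.∣ q ∣ ℚ.≤ ℚ.∣ p ℚ.- q ∣
∣∣-≤-∣-∣ p q = begin
  ℚ.∣ p ∣ ℚ.- ℚ.∣ q ∣
    ≡⟨ cong (λ z → ℚ.∣ z ∣ ℚ.- ℚ.∣ q ∣) (solve 2 (λ p q → p := (p :- q) :+ q) refl p q) ⟩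
  ℚ.∣ (p ℚ.- q) ℚ.+ q ∣ ℚ.- ℚ.∣ q ∣
    ≤⟨ ℚ.+-monoˡ-≤ (ℚ.- ℚ.∣ q ∣) (ℚ.∣p+q∣≤∣p∣+∣q∣ (p ℚ.- q) q) ⟩
  (ℚ.∣ p ℚ.- q ∣ ℚ.+ ℚ.∣ q ∣) ℚ.- ℚ.∣ q ∣
    ≡⟨ solve 2 (λ x y → (x :+ y) :- y := x) refl ℚ.∣ p ℚ.- q ∣ ℚ.∣ q ∣ ⟩
  ℚ.∣ p ℚ.- q ∣ ∎

∣∣∣-∣∣∣≤ : ∀ p q → ℚ.∣ ℚ.∣ p ∣ ℚ.- ℚ.∣ q ∣ ∣ ℚ.≤ ℚ.∣ p ℚ.- q ∣
∣∣∣-∣∣∣≤ p q with ℚ.∣p∣≡p∨∣p∣≡-p (ℚ.∣ p ∣ ℚ.- ℚ.∣ q ∣)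
... | inj₁ e = subst (ℚ._≤ ℚ.∣ p ℚ.- q ∣) (sym e) (∣∣-≤-∣-∣ p q)
... | inj₂ e = begin
  ℚ.∣ ℚ.∣ p ∣ ℚ.- ℚ.∣ q ∣ ∣  ≡⟨ e ⟩
  ℚ.- (ℚ.∣ p ∣ ℚ.- ℚ.∣ q ∣)  ≡⟨ solve 2 (λ x y → :- (x :- y) := y :- x) refl ℚ.∣ p ∣ ℚ.∣ q ∣ ⟩
  ℚ.∣ q ∣ ℚ.- ℚ.∣ p ∣        ≤⟨ ∣∣-≤-∣-∣ q p ⟩
  ℚ.∣ q ℚ.- p ∣              ≡⟨ ∣-∣-comm q p ⟩
  ℚ.∣ p ℚ.- q ∣              ∎

cauchy-abs : ∀ {a} → Cauchy a → Cauchy (λ n → ℚ.∣ a n ∣)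
cauchy-abs {a} h ε 0<ε with K , H ← h ε 0<ε =
  K , λ m n p q → ℚ.≤-<-trans (∣∣∣-∣∣∣≤ (a m) (a n)) (H m n p q)

eventuallyBounded : ∀ {a} → Cauchy a →
  ∃[ B ] 0ℚ ℚ.< B × ∃[ K ] ∀ n → K ℕ.≤ n → ℚ.∣ a n ∣ ℚ.≤ B
eventuallyBounded {a} h with K , H ← h 1ℚ (ℚ.positive⁻¹ 1ℚ) =
  B , ℚ.<-≤-trans (ℚ.positive⁻¹ 1ℚ) 1≤B , K , λ n p → begin
    ℚ.∣ a n ∣
      ≡⟨ solve 2 (λ x y → x := (x :- y) :+ y) refl ℚ.∣ a n ∣ ℚ.∣ a K ∣ ⟩
    (ℚ.∣ a n ∣ ℚ.- ℚ.∣ a K ∣) ℚ.+ ℚ.∣ a K ∣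
      ≤⟨ ℚ.+-monoˡ-≤ ℚ.∣ a K ∣ (ℚ.≤-trans (∣∣-≤-∣-∣ (a n) (a K)) (ℚ.<⇒≤ (H n K p ℕ.≤-refl))) ⟩
    B ∎
  where
  B = 1ℚ ℚ.+ ℚ.∣ a K ∣
  1≤B : 1ℚ ℚ.≤ B
  1≤B = begin
    1ℚ          ≡⟨ ℚ.+-identityʳ 1ℚ ⟨
    1ℚ ℚ.+ 0ℚ   ≤⟨ ℚ.+-monoʳ-≤ 1ℚ (ℚ.0≤∣p∣ (a K)) ⟩
    B           ∎

*-mono-≤ℚ : ∀ {x y z w} → 0ℚ ℚ.≤ z → 0ℚ ℚ.≤ y → x ℚ.≤ y → z ℚ.≤ w → x ℚ.* z ℚ.≤ y ℚ.* w
*-mono-≤ℚ {x} {y} {z} {w} 0≤z 0≤y x≤y z≤w = ℚ.≤-trans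
  (ℚ.*-monoʳ-≤-nonNeg z {{ℚ.nonNegative 0≤z}} x≤y)
  (ℚ.*-monoˡ-≤-nonNeg y {{ℚ.nonNegative 0≤y}} z≤w)

*-difference : ∀ x y z w → x ℚ.* y ℚ.- z ℚ.* w ≡ z ℚ.* (y ℚ.- w) ℚ.+ (x ℚ.- z) ℚ.* y
*-difference = solve 4 (λ x y z w → x :* y :- z :* w := z :* (y :- w) :+ (x :- z) :* y) refl

∣*-difference∣≤ : ∀ {A B δ x y z w} → 0ℚ ℚ.≤ A → 0ℚ ℚ.≤ δ →
  ℚ.∣ z ∣ ℚ.≤ A → ℚ.∣ y ∣ ℚ.≤ B → ℚ.∣ x ℚ.- z ∣ ℚ.≤ δ → ℚ.∣ y ℚ.- w ∣ ℚ.≤ δ →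
  ℚ.∣ x ℚ.* y ℚ.- z ℚ.* w ∣ ℚ.≤ δ ℚ.* (A ℚ.+ B)
∣*-difference∣≤ {A} {B} {δ} {x} {y} {z} {w} 0≤A 0≤δ z≤ y≤ x-z≤ y-w≤ = begin
  ℚ.∣ x ℚ.* y ℚ.- z ℚ.* w ∣
    ≡⟨ cong ℚ.∣_∣ (*-difference x y z w) ⟩
  ℚ.∣ z ℚ.* (y ℚ.- w) ℚ.+ (x ℚ.- z) ℚ.* y ∣
    ≤⟨ ℚ.∣p+q∣≤∣p∣+∣q∣ (z ℚ.* (y ℚ.- w)) ((x ℚ.- z) ℚ.* y) ⟩
  ℚ.∣ z ℚ.* (y ℚ.- w) ∣ ℚ.+ ℚ.∣ (x ℚ.- z) ℚ.* y ∣
    ≡⟨ cong₂ ℚ._+_ (ℚ.∣p*q∣≡∣p∣*∣q∣ z (y ℚ.- w)) (ℚ.∣p*q∣≡∣p∣*∣q∣ (x ℚ.- z) y) ⟩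
  ℚ.∣ z ∣ ℚ.* ℚ.∣ y ℚ.- w ∣ ℚ.+ ℚ.∣ x ℚ.- z ∣ ℚ.* ℚ.∣ y ∣
    ≤⟨ ℚ.+-mono-≤ (*-mono-≤ℚ (ℚ.0≤∣p∣ (y ℚ.- w)) 0≤A z≤ y-w≤) (*-mono-≤ℚ (ℚ.0≤∣p∣ y) 0≤δ x-z≤ y≤) ⟩
  A ℚ.* δ ℚ.+ δ ℚ.* B
    ≡⟨ cong (ℚ._+ δ ℚ.* B) (ℚ.*-comm A δ) ⟩
  δ ℚ.* A ℚ.+ δ ℚ.* B
    ≡⟨ ℚ.*-distribˡ-+ δ A B ⟨
  δ ℚ.* (A ℚ.+ B) ∎

divide : ∀ ε C → 0ℚ ℚ.< ε → 0ℚ ℚ.< C → ∃[ δ ] 0ℚ ℚ.< δ × δ ℚ.* C ≡ ε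
divide ε C 0<ε 0<C = ε ℚ.* (ℚ.1/ C) ,
  ℚ.positive⁻¹ (ε ℚ.* (ℚ.1/ C)) {{ℚ.pos*pos⇒pos ε {{ℚ.positive 0<ε}} (ℚ.1/ C) {{ℚ.1/pos⇒pos C}}}} ,
  trans (ℚ.*-assoc ε (ℚ.1/ C) C) (trans (cong (ε ℚ.*_) (ℚ.*-inverseˡ C)) (ℚ.*-identityʳ ε))
  where
  instance
    C-pos : ℚ.Positive C
    C-pos = ℚ.positive 0<C
    C-nonZero : ℚ.NonZero C
    C-nonZero = ℚ.pos⇒nonZero C

cauchy-* : ∀ {a b} → Cauchy a → Cauchy b → Cauchy (λ n → a n ℚ.* b n)
cauchy-* {a} {b} h₁ h₂ = fromCauchy≤ {λ n → a n ℚ.* b n} λ ε 0<ε →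
  let A , 0<A , L₁ , G₁ = eventuallyBounded {a} h₁
      B , 0<B , L₂ , G₂ = eventuallyBounded {b} h₂
      δ , 0<δ , δC≡ε = divide ε (A ℚ.+ B) 0<ε (ℚ.+-mono-< 0<A 0<B)
      K₁ , H₁ = h₁ δ 0<δ
      K₂ , H₂ = h₂ δ 0<δ
      K = K₁ ℕ.⊔ K₂
      L = L₁ ℕ.⊔ L₂
  in K ℕ.⊔ L , λ m n p q →
    let pK = ℕ.m⊔n≤o⇒m≤o K L p ; qK = ℕ.m⊔n≤o⇒m≤o K L q
        pL = ℕ.m⊔n≤o⇒n≤o K L p ; qL = ℕ.m⊔n≤o⇒n≤o K L q
    in subst (ℚ.∣ a m ℚ.* b m ℚ.- a n ℚ.* b n ∣ ℚ.≤_) δC≡ε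
      (∣*-difference∣≤ {x = a m} {b m} {a n} {b n} (ℚ.<⇒≤ 0<A) (ℚ.<⇒≤ 0<δ)
        (G₁ n (ℕ.m⊔n≤o⇒m≤o L₁ L₂ qL))
        (G₂ m (ℕ.m⊔n≤o⇒n≤o L₁ L₂ pL))
        (ℚ.<⇒≤ (H₁ m n (ℕ.m⊔n≤o⇒m≤o K₁ K₂ pK) (ℕ.m⊔n≤o⇒m≤o K₁ K₂ qK)))
        (ℚ.<⇒≤ (H₂ m n (ℕ.m⊔n≤o⇒n≤o K₁ K₂ pK) (ℕ.m⊔n≤o⇒n≤o K₁ K₂ qK))))

record ℝ : Set where
  constructor mkℝ
  field
    seq    : ℕ → ℚ
    cauchy : Cauchy seq

open ℝ public

fromℚ : ℚ → ℝ
fromℚ q = mkℝ (λ _ → q) (cauchy-const q)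

infixl 7 _*ʳ_
infixl 6 _-ʳ_
infix  4 _<ʳ_

_*ʳ_ : ℝ → ℝ → ℝ
x *ʳ y = mkℝ (λ m → seq x m ℚ.* seq y m) (cauchy-* {seq x} {seq y} (cauchy x) (cauchy y))

_-ʳ_ : ℝ → ℝ → ℝ
x -ʳ y = mkℝ (λ m → seq x m ℚ.- seq y m) (cauchy-+ {seq x} {λ m → ℚ.- seq y m} (cauchy x) (cauchy-neg {seq y} (cauchy y)))

∣_∣ʳ : ℝ → ℝ
∣ x ∣ʳ = mkℝ (λ m → ℚ.∣ seq x m ∣) (cauchy-abs {seq x} (cauchy x))

-- A uniform positive gap δ is needed: termwise _<_ alone would not separate limits.
_<ʳ_ : ℝ → ℝ → Set
x <ʳ y = ∃[ δ ] 0ℚ ℚ.< δ × ∃[ K ] ∀ m → K ℕ.≤ m → seq x m ℚ.+ δ ℚ.≤ seq y m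

open Algebra.Definitions.RawSemiring ℚ.+-*-rawSemiring using (_^_)

expTerm : ℚ → ℕ → ℚ
expTerm q i = (q ^ i) ℚ.* ((+ 1 ℚ./ i !) {{i ℕ.!≢0}})

sumBelow : (ℕ → ℚ) → ℕ → ℚ
sumBelow f zero    = 0ℚ
sumBelow f (suc m) = sumBelow f m ℚ.+ f m

ι : ℕ → ℚ
ι m = + m ℚ./ 1

toℚᵘ-/ : ∀ i d → ℚ.toℚᵘ (i ℚ./ suc d) ℚᵘ.≃ mkℚᵘ i d
toℚᵘ-/ i d = ℚ.toℚᵘ-fromℚᵘ (mkℚᵘ i d)

/-*-/ : ∀ i j d e → (i ℚ./ suc d) ℚ.* (j ℚ./ suc e) ≡ (i ℤ.* j) ℚ./ (suc d ℕ.* suc e)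
/-*-/ i j d e = ℚ.toℚᵘ-injective (ℚᵘ.≃-trans
  (ℚ.toℚᵘ-homo-* (i ℚ./ suc d) (j ℚ./ suc e))
  (ℚᵘ.≃-trans (ℚᵘ.*-cong (toℚᵘ-/ i d) (toℚᵘ-/ j e))
    (ℚᵘ.≃-sym (toℚᵘ-/ (i ℤ.* j) (e ℕ.+ d ℕ.* suc e)))))

/-≤ : ∀ i j d e → i ℤ.* + suc e ℤ.≤ j ℤ.* + suc d → i ℚ./ suc d ℚ.≤ j ℚ./ suc e
/-≤ i j d e h = ℚ.toℚᵘ-cancel-≤
  (ℚᵘ.≤-trans (ℚᵘ.≤-reflexive (toℚᵘ-/ i d))
    (ℚᵘ.≤-trans (ℚᵘ.*≤* h) (ℚᵘ.≤-reflexive (ℚᵘ.≃-sym (toℚᵘ-/ j e)))))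

1/-* : ∀ a b .{{_ : NonZero a}} .{{_ : NonZero b}} →
  (+ 1 ℚ./ (a ℕ.* b)) {{ℕ.m*n≢0 a b}} ≡ (+ 1 ℚ./ a) ℚ.* (+ 1 ℚ./ b)
1/-* (suc a) (suc b) = sym (/-*-/ (+ 1) (+ 1) a b)

ι-mono : ∀ {a b} → a ℕ.≤ b → ι a ℚ.≤ ι b
ι-mono {a} {b} h = /-≤ (+ a) (+ b) 0 0 (ℤ.*-monoʳ-≤-nonNeg (+ 1) (ℤ.+≤+ h))

ι-* : ∀ a b → ι (a ℕ.* b) ≡ ι a ℚ.* ι b
ι-* a b = trans (cong (λ z → z ℚ./ 1) (ℤ.pos-* a b)) (sym (/-*-/ (+ a) (+ b) 0 0))

ι-suc : ∀ a → ι (suc a) ≡ 1ℚ ℚ.+ ι a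
ι-suc a = ℚ.toℚᵘ-injective (ℚᵘ.≃-trans (toℚᵘ-/ (+ suc a) 0)
  (ℚᵘ.≃-trans (ℚᵘ.*≡* (cong (λ z → (+ 1 ℤ.+ z) ℤ.* + 1) (sym (ℤ.*-identityʳ (+ a)))))
    (ℚᵘ.≃-sym (ℚᵘ.≃-trans (ℚ.toℚᵘ-homo-+ 1ℚ (ι a)) (ℚᵘ.+-congʳ (ℚ.toℚᵘ 1ℚ) (toℚᵘ-/ (+ a) 0))))))

0≤ι : ∀ a → 0ℚ ℚ.≤ ι a
0≤ι a = ι-mono {0} {a} z≤n

p≤ι∣↥p∣ : ∀ p → p ℚ.≤ ι ℤ.∣ ℚ.↥ p ∣
p≤ι∣↥p∣ p@record{} = subst (ℚ._≤ ι ℤ.∣ ℚ.↥ p ∣) (ℚ.↥p/↧p≡p p)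
  (/-≤ (ℚ.↥ p) (+ ℤ.∣ ℚ.↥ p ∣) (ℚ.denominator-1 p) 0 (bound (ℚ.↥ p) (ℚ.denominator-1 p)))
  where
  bound : ∀ i d → i ℤ.* + 1 ℤ.≤ + ℤ.∣ i ∣ ℤ.* + suc d
  bound (+ a) d = ℤ.*-monoˡ-≤-nonNeg (+ a) (ℤ.+≤+ (s≤s (z≤n {d})))
  bound ℤ.-[1+ a ] d = ℤ.-≤+

1≤ι↧*p : ∀ p → 0ℚ ℚ.< p → 1ℚ ℚ.≤ ι (ℚ.↧ₙ p) ℚ.* p
1≤ι↧*p p 0<p = go p {{ℚ.positive 0<p}}
  where
  go : ∀ p .{{_ : ℚ.Positive p}} → 1ℚ ℚ.≤ ι (ℚ.↧ₙ p) ℚ.* p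
  go p@(ℚ.mkℚ ℤ.+[1+ e ] d _) =
    subst (λ z → 1ℚ ℚ.≤ ι (suc d) ℚ.* z) (ℚ.↥p/↧p≡p p)
      (subst (1ℚ ℚ.≤_) (sym (/-*-/ (+ suc d) (+ suc e) 0 d))
        (/-≤ (+ 1) (+ suc d ℤ.* + suc e) 0 (d ℕ.+ 0) 
          (ℤ.+≤+ (ℕ.≤-trans (ℕ.≤-reflexive (trans (ℕ.*-identityˡ _) (ℕ.*-identityˡ (suc d))))
            (ℕ.≤-trans (ℕ.m≤m*n (suc d) (suc e)) (ℕ.≤-reflexive (sym (ℕ.*-identityʳ _))))))))

archimedean : ∀ p ε → 0ℚ ℚ.< ε → ∃[ j ] p ℚ.≤ ι j ℚ.* ε
archimedean p ε 0<ε = ℤ.∣ ℚ.↥ p ∣ ℕ.* ℚ.↧ₙ ε , (begin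
  p                                        ≤⟨ p≤ι∣↥p∣ p ⟩
  ι ℤ.∣ ℚ.↥ p ∣                            ≡⟨ ℚ.*-identityʳ _ ⟨
  ι ℤ.∣ ℚ.↥ p ∣ ℚ.* 1ℚ                     ≤⟨ ℚ.*-monoˡ-≤-nonNeg (ι ℤ.∣ ℚ.↥ p ∣)
                                                {{ℚ.nonNegative (0≤ι ℤ.∣ ℚ.↥ p ∣)}} (1≤ι↧*p ε 0<ε) ⟩
  ι ℤ.∣ ℚ.↥ p ∣ ℚ.* (ι (ℚ.↧ₙ ε) ℚ.* ε)     ≡⟨ ℚ.*-assoc (ι ℤ.∣ ℚ.↥ p ∣) (ι (ℚ.↧ₙ ε)) ε ⟨
  ι ℤ.∣ ℚ.↥ p ∣ ℚ.* ι (ℚ.↧ₙ ε) ℚ.* ε       ≡⟨ cong (ℚ._* ε) (ι-* ℤ.∣ ℚ.↥ p ∣ (ℚ.↧ₙ ε)) ⟨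
  ι (ℤ.∣ ℚ.↥ p ∣ ℕ.* ℚ.↧ₙ ε) ℚ.* ε         ∎)

-- A series whose terms are eventually at least halved at each step.
module HalvingSeries (a : ℕ → ℚ) (K : ℕ)
  (halving : ∀ m → K ℕ.≤ m → ℚ.∣ a (suc m) ∣ ℚ.≤ ½ ℚ.* ℚ.∣ a m ∣) where

  tail≤ : ∀ m → K ℕ.≤ m → ∀ d →
    ℚ.∣ sumBelow a (d ℕ.+ m) ℚ.- sumBelow a m ∣ ℚ.≤ ι 2 ℚ.* (ℚ.∣ a m ∣ ℚ.- ℚ.∣ a (d ℕ.+ m) ∣)
  tail≤ m _ zero = ℚ.≤-reflexive (trans
    (cong ℚ.∣_∣ (ℚ.+-inverseʳ (sumBelow a m)))
    (solve 1 (λ x → con 0ℚ := con (ι 2) :* (x :- x)) refl ℚ.∣ a m ∣))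
  tail≤ m K≤m (suc d) = begin
    ℚ.∣ (S ℚ.+ a (d ℕ.+ m)) ℚ.- sumBelow a m ∣
      ≡⟨ cong ℚ.∣_∣ (solve 3 (λ s t r → (s :+ t) :- r := (s :- r) :+ t) refl S (a (d ℕ.+ m)) (sumBelow a m)) ⟩
    ℚ.∣ (S ℚ.- sumBelow a m) ℚ.+ a (d ℕ.+ m) ∣
      ≤⟨ ℚ.∣p+q∣≤∣p∣+∣q∣ (S ℚ.- sumBelow a m) (a (d ℕ.+ m)) ⟩
    ℚ.∣ S ℚ.- sumBelow a m ∣ ℚ.+ u
      ≤⟨ ℚ.+-monoˡ-≤ u (tail≤ m K≤m d) ⟩
    ι 2 ℚ.* (ℚ.∣ a m ∣ ℚ.- u) ℚ.+ u
      ≡⟨ solve 2 (λ x u → con (ι 2) :* (x :- u) :+ u := con (ι 2) :* (x :- con ½ :* u)) refl ℚ.∣ a m ∣ u ⟩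
    ι 2 ℚ.* (ℚ.∣ a m ∣ ℚ.- ½ ℚ.* u)
      ≤⟨ ℚ.*-monoˡ-≤-nonNeg (ι 2) (ℚ.+-monoʳ-≤ ℚ.∣ a m ∣
           (ℚ.neg-antimono-≤ (halving (d ℕ.+ m) (ℕ.≤-trans K≤m (ℕ.m≤n+m m d))))) ⟩
    ι 2 ℚ.* (ℚ.∣ a m ∣ ℚ.- ℚ.∣ a (suc d ℕ.+ m) ∣) ∎
    where
    S = sumBelow a (d ℕ.+ m)
    u = ℚ.∣ a (d ℕ.+ m) ∣

  term≤ : ∀ j → ι (suc j) ℚ.* ℚ.∣ a (j ℕ.+ K) ∣ ℚ.≤ ℚ.∣ a K ∣
  term≤ zero    = ℚ.≤-reflexive (ℚ.*-identityˡ ℚ.∣ a K ∣)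
  term≤ (suc j) = begin
    ι (2 ℕ.+ j) ℚ.* ℚ.∣ a (suc j ℕ.+ K) ∣
      ≤⟨ ℚ.*-monoˡ-≤-nonNeg (ι (2 ℕ.+ j)) {{ℚ.nonNegative (0≤ι (2 ℕ.+ j))}} (halving (j ℕ.+ K) (ℕ.m≤n+m K j)) ⟩
    ι (2 ℕ.+ j) ℚ.* (½ ℚ.* u)
      ≡⟨ ℚ.*-assoc (ι (2 ℕ.+ j)) ½ u ⟨
    ι (2 ℕ.+ j) ℚ.* ½ ℚ.* u
      ≤⟨ ℚ.*-monoʳ-≤-nonNeg u {{ℚ.∣-∣-nonNeg (a (j ℕ.+ K))}} half ⟩
    ι (suc j) ℚ.* u
      ≤⟨ term≤ j ⟩
    ℚ.∣ a K ∣ ∎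
    where
    u = ℚ.∣ a (j ℕ.+ K) ∣
    half : ι (2 ℕ.+ j) ℚ.* ½ ℚ.≤ ι (suc j)
    half = begin
      ι (2 ℕ.+ j) ℚ.* ½                ≡⟨ cong (ℚ._* ½) (ι-suc (suc j)) ⟩
      (1ℚ ℚ.+ ι (suc j)) ℚ.* ½         ≤⟨ ℚ.*-monoʳ-≤-nonNeg ½ (ℚ.+-monoˡ-≤ (ι (suc j)) (ι-mono {1} {suc j} (s≤s z≤n))) ⟩
      (ι (suc j) ℚ.+ ι (suc j)) ℚ.* ½  ≡⟨ solve 1 (λ x → (x :+ x) :* con ½ := x) refl (ι (suc j)) ⟩
      ι (suc j)                        ∎

  cauchy-sum : Cauchy (sumBelow a)
  cauchy-sum = fromBase {sumBelow a} λ ε 0<ε →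
    let j , H = archimedean (ι 2 ℚ.* ℚ.∣ a K ∣) ε 0<ε
        M = j ℕ.+ K
        instance
          ι-pos : ℚ.Positive (ι (suc j))
          ι-pos = ℚ.normalize-pos (suc j) 1
    in M , λ m M≤m → begin
      ℚ.∣ sumBelow a m ℚ.- sumBelow a M ∣
        ≡⟨ cong (λ z → ℚ.∣ sumBelow a z ℚ.- sumBelow a M ∣) (ℕ.m∸n+n≡m M≤m) ⟨
      ℚ.∣ sumBelow a (m ℕ.∸ M ℕ.+ M) ℚ.- sumBelow a M ∣
        ≤⟨ tail≤ M (ℕ.m≤n+m K j) (m ℕ.∸ M) ⟩
      ι 2 ℚ.* (ℚ.∣ a M ∣ ℚ.- ℚ.∣ a (m ℕ.∸ M ℕ.+ M) ∣)
        ≤⟨ ℚ.*-monoˡ-≤-nonNeg (ι 2) (ℚ.+-monoʳ-≤ ℚ.∣ a M ∣ (ℚ.neg-antimono-≤ (ℚ.0≤∣p∣ (a (m ℕ.∸ M ℕ.+ M))))) ⟩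
      ι 2 ℚ.* (ℚ.∣ a M ∣ ℚ.- 0ℚ)
        ≡⟨ cong (ι 2 ℚ.*_) (ℚ.+-identityʳ ℚ.∣ a M ∣) ⟩
      ι 2 ℚ.* ℚ.∣ a M ∣
        ≤⟨ ℚ.*-cancelˡ-≤-pos (ι (suc j)) (begin
             ι (suc j) ℚ.* (ι 2 ℚ.* ℚ.∣ a M ∣)
               ≡⟨ solve 2 (λ x y → x :* (con (ι 2) :* y) := con (ι 2) :* (x :* y)) refl (ι (suc j)) ℚ.∣ a M ∣ ⟩
             ι 2 ℚ.* (ι (suc j) ℚ.* ℚ.∣ a M ∣)
               ≤⟨ ℚ.*-monoˡ-≤-nonNeg (ι 2) (term≤ j) ⟩
             ι 2 ℚ.* ℚ.∣ a K ∣
               ≤⟨ H ⟩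
             ι j ℚ.* ε
               ≤⟨ ℚ.*-monoʳ-≤-nonNeg ε {{ℚ.nonNegative (ℚ.<⇒≤ 0<ε)}} (ι-mono (ℕ.n≤1+n j)) ⟩
             ι (suc j) ℚ.* ε ∎) ⟩
      ε ∎

expTerm-suc : ∀ q i → expTerm q (suc i) ≡ q ℚ.* (+ 1 ℚ./ suc i) ℚ.* expTerm q i
expTerm-suc q i = begin-equality
  q ℚ.* (q ^ i) ℚ.* ((+ 1 ℚ./ suc i !) {{suc i ℕ.!≢0}})
    ≡⟨ cong (q ℚ.* (q ^ i) ℚ.*_) (1/-* (suc i) (i !) {{_}} {{i ℕ.!≢0}}) ⟩
  q ℚ.* (q ^ i) ℚ.* ((+ 1 ℚ./ suc i) ℚ.* r)
    ≡⟨ solve 4 (λ q p s r → q :* p :* (s :* r) := q :* s :* (p :* r)) refl q (q ^ i) (+ 1 ℚ./ suc i) r ⟩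
  q ℚ.* (+ 1 ℚ./ suc i) ℚ.* expTerm q i ∎
  where r = (+ 1 ℚ./ i !) {{i ℕ.!≢0}}

expTerm-halving : ∀ q m → 2 ℕ.* ℤ.∣ ℚ.↥ ℚ.∣ q ∣ ∣ ℕ.≤ m →
  ℚ.∣ expTerm q (suc m) ∣ ℚ.≤ ½ ℚ.* ℚ.∣ expTerm q m ∣
expTerm-halving q m h = begin
  ℚ.∣ expTerm q (suc m) ∣                      ≡⟨ cong ℚ.∣_∣ (expTerm-suc q m) ⟩
  ℚ.∣ q ℚ.* s ℚ.* expTerm q m ∣                ≡⟨ ℚ.∣p*q∣≡∣p∣*∣q∣ (q ℚ.* s) (expTerm q m) ⟩
  ℚ.∣ q ℚ.* s ∣ ℚ.* ℚ.∣ expTerm q m ∣          ≤⟨ ℚ.*-monoʳ-≤-nonNeg ℚ.∣ expTerm q m ∣ {{ℚ.∣-∣-nonNeg (expTerm q m)}} ratio ⟩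
  ½ ℚ.* ℚ.∣ expTerm q m ∣                      ∎
  where
  s = + 1 ℚ./ suc m
  M = ℤ.∣ ℚ.↥ ℚ.∣ q ∣ ∣
  0≤s : 0ℚ ℚ.≤ s
  0≤s = /-≤ (+ 0) (+ 1) 0 m (ℤ.+≤+ z≤n)
  ratio : ℚ.∣ q ℚ.* s ∣ ℚ.≤ ½
  ratio = begin
    ℚ.∣ q ℚ.* s ∣            ≡⟨ ℚ.∣p*q∣≡∣p∣*∣q∣ q s ⟩
    ℚ.∣ q ∣ ℚ.* ℚ.∣ s ∣      ≡⟨ cong (ℚ.∣ q ∣ ℚ.*_) (ℚ.0≤p⇒∣p∣≡p 0≤s) ⟩
    ℚ.∣ q ∣ ℚ.* s            ≤⟨ ℚ.*-monoʳ-≤-nonNeg s {{ℚ.nonNegative 0≤s}} (p≤ι∣↥p∣ ℚ.∣ q ∣) ⟩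
    ι M ℚ.* s                ≡⟨ /-*-/ (+ M) (+ 1) 0 m ⟩
    (+ M ℤ.* + 1) ℚ./ (1 ℕ.* suc m)
      ≤⟨ /-≤ (+ M ℤ.* + 1) (+ 1) (m ℕ.+ 0) 1
           (subst (ℤ._≤ + (suc (m ℕ.+ 0) ℕ.+ 0)) (trans (cong +_ (ℕ.*-comm 2 M)) (trans (ℤ.pos-* M 2) (cong (ℤ._* + 2) (sym (ℤ.*-identityʳ (+ M))))))
             (ℤ.+≤+ (ℕ.≤-trans h (ℕ.≤-trans (ℕ.n≤1+n m) (ℕ.≤-reflexive (sym (trans (ℕ.+-identityʳ _) (ℕ.+-identityʳ (suc m))))))))) ⟩
    ½                        ∎

-- Partial sums of the series Σ qⁱ / i!.
exp : ℚ → ℝ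
exp q = mkℝ (sumBelow (expTerm q)) cauchy-sum
  where open HalvingSeries (expTerm q) (2 ℕ.* ℤ.∣ ℚ.↥ ℚ.∣ q ∣ ∣) (expTerm-halving q)

-- The sequence is only defined for indices n ≥ n₀.
Limit : (n₀ : ℕ) → ((n : ℕ) → n₀ ℕ.≤ n → ℝ) → ℝ → Set
Limit n₀ x L = ∀ ε → 0ℚ ℚ.< ε →
  ∃[ M ] ∀ n (n₀≤n : n₀ ℕ.≤ n) → M ℕ.≤ n → ∣ x n n₀≤n -ʳ L ∣ʳ <ʳ fromℚ ε

-- Each of the k disjoint sets is a copy of Fin n, so the i-th entry, a function
-- from the i-th set to its cyclic successor, is a vector of n values in Fin n.
Tuple : ℕ → ℕ → Set
Tuple k n = Vec (Vec (Fin n) n) k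

-- For (f₁ , … , f_k) this is f_k ∘ ⋯ ∘ f₁, a self-map of the first set.
composite : Tuple k n → Fin n → Fin n
composite []       x = x
composite (f ∷ fs) x = composite fs (lookup f x)

image : (Fin n → Fin n) → Subset n
image h = tabulate λ y → does (any? λ x → h x ≟ y)

-- s enumerates S without repetition and g is the cyclic permutation (s 0 , … , s (N-1)).
ActsAsCycleOn : (N : ℕ) .{{_ : NonZero N}} → (Fin n → Fin n) → Subset n → Set
ActsAsCycleOn {n} N g S = ∃ λ (s : Fin N → Fin n) →
  Injective _≡_ _≡_ s ×
  (∀ x → x ∈ S ⇔ (∃[ i ] s i ≡ x)) ×
  (∀ i → g (s i) ≡ s (suc (toℕ i) mod N))

-- The iterated image gᵐ(Fin n) equals S for all large m.
StabilizesTo : (Fin n → Fin n) → Subset n → Set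
StabilizesTo g S = ∃[ M ] ∀ m → M ℕ.≤ m → image (λ x → iterate g x m) ≡ S

EventuallyCyclic : (N : ℕ) .{{_ : NonZero N}} → Tuple k n → Set
EventuallyCyclic {n = n} N fs = ∃ λ (S : Subset n) →
  StabilizesTo (composite fs) S × ∣ S ∣ ≡ N × ActsAsCycleOn N (composite fs) S

∈-image⁺ : ∀ (h : Fin n → Fin n) x → h x ∈ image h
∈-image⁺ h x = lookup⇒[]= (h x) (image h)
  (trans (lookup∘tabulate _ (h x)) (dec-true (any? λ z → h z ≟ h x) (x , refl)))

∈-image⁻ : ∀ (h : Fin n → Fin n) {y} → y ∈ image h → ∃[ x ] h x ≡ y
∈-image⁻ h {y} y∈ with any? (λ x → h x ≟ y) | trans (sym (lookup∘tabulate _ y)) ([]=⇒lookup y∈)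
... | yes p | _ = p

iterate-suc : ∀ (g : Fin n → Fin n) x m → iterate g x (suc m) ≡ g (iterate g x m)
iterate-suc g x zero    = refl
iterate-suc g x (suc m) = iterate-suc g (g x) m

module Stabilization (g : Fin n → Fin n) where

  I : ℕ → Subset n
  I m = image (λ x → iterate g x m)

  decreasing : ∀ m → I (suc m) ⊆ I m
  decreasing m y∈ with x , refl ← ∈-image⁻ (λ x → iterate g x (suc m)) y∈ =
    ∈-image⁺ (λ x → iterate g x m) (g x)

  stable-suc : ∀ m → I (suc m) ≡ I m → I (2 ℕ.+ m) ≡ I (suc m)
  stable-suc m e = ⊆-antisym (decreasing (suc m)) back
    where
    back : I (suc m) ⊆ I (2 ℕ.+ m)
    back y∈ with x , refl ← ∈-image⁻ (λ x → iterate g x (suc m)) y∈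
      with z , eq ← ∈-image⁻ (λ x → iterate g x (suc m))
                      (subst (iterate g x m ∈_) (sym e) (∈-image⁺ (λ x → iterate g x m) x)) =
      subst (_∈ I (2 ℕ.+ m))
        (trans (iterate-suc g z (suc m)) (trans (cong g eq) (sym (iterate-suc g x m))))
        (∈-image⁺ (λ x → iterate g x (2 ℕ.+ m)) z)

  shrink : ∀ m → I (suc m) ≡ I m ⊎ ∣ I (suc m) ∣ ℕ.< ∣ I m ∣
  shrink m with all? (λ y → y ∈? I m →-dec y ∈? I (suc m))
  ... | yes h = inj₁ (⊆-antisym (decreasing m) (λ {y} → h y))
  ... | no ¬h with any? (λ y → (y ∈? I m) ×-dec ¬? (y ∈? I (suc m)))
  ...   | yes (y , y∈ , y∉) = inj₂ (p⊂q⇒∣p∣<∣q∣ (decreasing m , y , y∈ , y∉))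
  ...   | no ¬e = contradiction
    (λ y y∈ → decidable-stable (y ∈? I (suc m)) (λ y∉ → ¬e (y , y∈ , y∉))) ¬h

  stableOrSmall : ∀ m → I (suc m) ≡ I m ⊎ ∣ I m ∣ ℕ.+ m ℕ.≤ n
  stableOrSmall zero    = inj₂ (subst (ℕ._≤ n) (sym (ℕ.+-identityʳ ∣ I 0 ∣)) (∣p∣≤n (I 0)))
  stableOrSmall (suc m) with stableOrSmall m | shrink m
  ... | inj₁ e | _      = inj₁ (stable-suc m e)
  ... | inj₂ _ | inj₁ e = inj₁ (stable-suc m e)
  ... | inj₂ p | inj₂ q = inj₂ (ℕ.≤-trans
    (ℕ.≤-reflexive (ℕ.+-suc ∣ I (suc m) ∣ m)) (ℕ.≤-trans (ℕ.+-monoˡ-≤ m q) p))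

  stable : I (2 ℕ.+ n) ≡ I (suc n)
  stable with stableOrSmall (suc n)
  ... | inj₁ e = e
  ... | inj₂ p = contradiction (ℕ.≤-trans (ℕ.m≤n+m (suc n) ∣ I (suc n) ∣) p) ℕ.1+n≰n

  limit : ∀ d → I (d ℕ.+ suc n) ≡ I (suc n)
  limit d = proj₁ (go d)
    where
    go : ∀ d → I (d ℕ.+ suc n) ≡ I (suc n) × I (suc d ℕ.+ suc n) ≡ I (d ℕ.+ suc n)
    go zero    = refl , stable
    go (suc d) with e , f ← go d = trans f e , stable-suc (d ℕ.+ suc n) f

  stabilizesTo : StabilizesTo g (I (suc n))
  stabilizesTo = suc n , λ m p → trans (cong I (sym (ℕ.m∸n+n≡m p))) (limit (m ℕ.∸ suc n))

  unique : ∀ {S T} → StabilizesTo g S → StabilizesTo g T → S ≡ T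
  unique (M , p) (K , q) = trans
    (sym (p (M ℕ.⊔ K) (ℕ.m≤m⊔n M K))) (q (M ℕ.⊔ K) (ℕ.m≤n⊔m M K))

actsAsCycleOn? : (N : ℕ) .{{_ : NonZero N}} (g : Fin n → Fin n) (S : Subset n) →
  Dec (ActsAsCycleOn N g S)
actsAsCycleOn? {n} N g S = map′
  (λ (j , inj , mem , step) → finToFun j ,
    (λ {x} {y} → inj x y) , (λ x → mk⇔ (proj₁ (mem x)) (proj₂ (mem x))) , step)
  (λ (s , inj , mem , step) →
    let e = finToFun-funToFin s in
    funToFin s ,
    (λ x y h → inj (trans (sym (e x)) (trans h (e y)))) ,
    (λ x → (λ x∈ → let i , eq = Equivalence.to (mem x) x∈ in i , trans (e i) eq) ,
           (λ (i , eq) → Equivalence.from (mem x) (i , trans (sym (e i)) eq))) ,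
    (λ i → trans (cong g (e i)) (trans (step i) (sym (e (suc (toℕ i) mod N))))))
  (any? {n = n ℕ.^ N} λ j → let s = finToFun j in
    (all? λ x → all? λ y → (s x ≟ s y) →-dec (x ≟ y)) ×-dec
    ((all? λ x → ((x ∈? S) →-dec any? (λ i → s i ≟ x)) ×-dec
                 (any? (λ i → s i ≟ x) →-dec (x ∈? S))) ×-dec
     (all? λ i → g (s i) ≟ s (suc (toℕ i) mod N))))

eventuallyCyclic? : (N : ℕ) .{{_ : NonZero N}} (fs : Tuple k n) → Dec (EventuallyCyclic N fs)
eventuallyCyclic? {n = n} N fs = map′
  (λ h → I (suc n) , stabilizesTo , h)
  (λ (S , st , h) → subst (λ T → ∣ T ∣ ≡ N × ActsAsCycleOn N (composite fs) T) (unique st stabilizesTo) h)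
  ((∣ I (suc n) ∣ ℕ.≟ N) ×-dec actsAsCycleOn? N (composite fs) (I (suc n)))
  where open Stabilization (composite fs)

-- Lists every vector over a repetition-free list exactly once.
allVecs : {A : Set} → List A → ∀ m → List (Vec A m)
allVecs xs zero    = [] ∷ []
allVecs xs (suc m) = cartesianProductWith _∷_ xs (allVecs xs m)

allTuples : ∀ k n → List (Tuple k n)
allTuples k n = allVecs (allVecs (allFin n) n) k

-- There are (n ^ n) ^ k = n ^ (k * n) tuples.
probability : (k N n : ℕ) .{{_ : NonZero N}} .{{n≢0 : NonZero n}} → ℚ
probability k N n =
  (+ length (filter (eventuallyCyclic? N) (allTuples k n)) ℚ./ (n ℕ.^ (k ℕ.* n)))
    {{ℕ.m^n≢0 n (k ℕ.* n)}}

{-# OPTIONS --safe #-}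

-- Let g be the composite of a k-tuple on n-element sets, and call the eventual image of g its core.
-- A uniformly random function acts on N distinct points like N independent choices.  Hence the expected
-- number of vectors s of N distinct elements that g rotates is R_N^k, where R_N = n(n-1)⋯(n-N+1) / n^N,
-- and the same holds for any other prescribed permutation of the entries of s.
--
-- The pairs (tuple, s) whose vector s does not exhaust the core are in bijection with the triples
-- (tuple, s, x) where g rotates s and x is a fixed point outside s; the expected number of such (s, x)
-- is R_{N+1}^k.  The remaining pairs are N for each eventually N-cyclic tuple, hence
--
--   N p_{k,N}(n) = R_N^k - R_{N+1}^k = R_N^k (1 - (1 - N/n)^k).
--
-- For k = c n, both R_N^c and (1 - N/n)^c have the form 1 - a/n + O(1/n²), with a = c C(N,2) and a = c N,
-- so it remains to see that their n-th powers tend to exp(-a).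

module Submission where

open import Defs
import Data.Nat.Properties as ℕ
open import Data.Product.Base using (∃; ∃-syntax; _×_; _,_; proj₁; proj₂)
import Data.Rational.Properties as ℚ
open import Relation.Binary.PropositionalEquality

-- Why marked fixed points count the pairs to be discarded: `g` permutes its core, and if it rotates
-- `s` it also permutes the rest of the core. A uniform permutation of a nonempty finite set has one
-- fixed point on average, and the empty set has none, so fixed points off `s` average to the
-- indicator that `s` does not exhaust the core. The bijection makes this explicit: a reference
-- element `c` of the core off `s` is chosen, and its image `x` is cut out of its cycle and left as
-- a fixed point; splicing `x` back in after `c` is the inverse. Both moves precompose with the same
-- transposition. They undo each other because `c` depends on the core and `s` alone, and the twist
-- changes neither. On the analytic side a real is a sequence of partial sums, so closeness to `exp`
-- has to hold for all late partial sums at once. The expansion of (1 + q/n)^n is compared with them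
-- term by term: its terms are those of the exponential series times the factors `ρ`, the same
-- products that count arrangements.

module Counting where

  open import Data.Bool.Base using (true; false; if_then_else_)
  open import Data.Fin.Base as Fin using (Fin; toℕ; fromℕ; inject₁; punchOut)
  open import Data.Fin.Permutation.Components using (transpose)
  import Data.Fin.Properties as Fin
  open import Data.Fin.Relation.Unary.Top using (view; ‵fromℕ; ‵inject₁)
  open import Data.Fin.Subset using (Subset; _∈_; _∉_; _⊆_; ∣_∣)
  open import Data.Fin.Subset.Properties using (_∈?_; ⊆-antisym)
  open import Data.List.Base
    using (List; []; _∷_; _++_; map; length; filter; allFin; cartesianProductWith; cartesianProduct)
  open import Data.List.Properties using (map-cong; map-∘; map-tabulate)
  open import Data.Nat.Base as ℕ using (ℕ; zero; suc; _+_; _*_; _^_)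
  open import Data.Nat.DivMod using (_mod_; _%_; m<n⇒m%n≡m; n%n≡0)
  open import Data.Nat.GeneralisedArithmetic using (iterate)
  open import Data.Nat.ListAction using (sum)
  open import Data.Nat.Solver using (module +-*-Solver)
  import Data.Product.Properties as Product
  open import Data.Unit.Base using (⊤; tt)
  open import Data.Vec.Base as Vec using (Vec; []; _∷_; _∷ʳ_; lookup; tabulate; _[_]≔_)
  import Data.Vec.Membership.DecPropositional as DecMembership
  open import Data.Vec.Membership.Propositional using () renaming (_∈_ to _∈ᵛ_; _∉_ to _∉ᵛ_)
  open import Data.Vec.Membership.Propositional.Properties using (∈-map⁺; ∈-lookup; ∈-tabulate⁺)
  import Data.Vec.Properties as Vec
  open import Data.Vec.Relation.Unary.Any as Any using (here; there)
  import Data.Vec.Relation.Unary.Any.Properties as Any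
  open import Function.Base using (_∘_; case_of_)
  open import Function.Bundles using (_⇔_; mk⇔; Equivalence)
  open import Function.Definitions using (Injective)
  open import Relation.Binary.Definitions using (DecidableEquality)
  open import Relation.Nullary using (Dec; yes; no; does; ¬_; ¬?; contradiction)
  open import Relation.Nullary.Decidable using (map′; _×-dec_; does-⇔; dec-true; dec-false; decidable-stable)
  open import Relation.Unary using (Pred; Decidable)
  open +-*-Solver using (solve; _:+_; _:*_; _:=_)

  private variable
    A B C : Set
    P Q : Set
    k m n : ℕ

  -- Indicators, finite sums and double counting

  ⟦_⟧ : Dec P → ℕ
  ⟦ d ⟧ = if does d then 1 else 0

  ⟦⟧-yes : (d : Dec P) → P → ⟦ d ⟧ ≡ 1
  ⟦⟧-yes d p = cong (if_then 1 else 0) (dec-true d p)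

  ⟦⟧-no : (d : Dec P) → ¬ P → ⟦ d ⟧ ≡ 0
  ⟦⟧-no d ¬p = cong (if_then 1 else 0) (dec-false d ¬p)

  ⟦⟧-cong : (d : Dec P) (e : Dec Q) → P ⇔ Q → ⟦ d ⟧ ≡ ⟦ e ⟧
  ⟦⟧-cong d e P⇔Q = cong (if_then 1 else 0) (does-⇔ P⇔Q d e)

  ⟦⟧-× : (d : Dec P) (e : Dec Q) → ⟦ d ×-dec e ⟧ ≡ ⟦ d ⟧ * ⟦ e ⟧
  ⟦⟧-× (yes _) e = sym (ℕ.+-identityʳ ⟦ e ⟧)
  ⟦⟧-× (no  _) e = refl

  ⟦⟧*-cong : (d : Dec P) {a b : ℕ} → (P → a ≡ b) → ⟦ d ⟧ * a ≡ ⟦ d ⟧ * b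
  ⟦⟧*-cong (yes p) h = cong (1 *_) (h p)
  ⟦⟧*-cong (no _)  h = refl

  ∑ : List A → (A → ℕ) → ℕ
  ∑ xs f = sum (map f xs)

  infix 4 ∑
  syntax ∑ xs (λ x → e) = ∑[ x ∈ xs ] e

  ∑-cong : ∀ (xs : List A) {f g} → (∀ x → f x ≡ g x) → ∑ xs f ≡ ∑ xs g
  ∑-cong xs h = cong sum (map-cong h xs)

  ∑-+ : ∀ (xs : List A) f g → (∑[ x ∈ xs ] f x + g x) ≡ ∑ xs f + ∑ xs g
  ∑-+ []       f g = refl
  ∑-+ (x ∷ xs) f g = trans (cong (f x + g x +_) (∑-+ xs f g))
    (solve 4 (λ a b c d → a :+ b :+ (c :+ d) := a :+ c :+ (b :+ d)) refl (f x) (g x) (∑ xs f) (∑ xs g))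

  ∑-*ˡ : ∀ (xs : List A) c f → (∑[ x ∈ xs ] c * f x) ≡ c * ∑ xs f
  ∑-*ˡ []       c f = sym (ℕ.*-zeroʳ c)
  ∑-*ˡ (x ∷ xs) c f = trans (cong (c * f x +_) (∑-*ˡ xs c f)) (sym (ℕ.*-distribˡ-+ c (f x) _))

  ∑-*ʳ : ∀ (xs : List A) c f → (∑[ x ∈ xs ] f x * c) ≡ ∑ xs f * c
  ∑-*ʳ xs c f = trans (∑-cong xs λ x → ℕ.*-comm (f x) c) (trans (∑-*ˡ xs c f) (ℕ.*-comm c _))

  ∑-0 : ∀ (xs : List A) → (∑[ _ ∈ xs ] 0) ≡ 0
  ∑-0 []       = refl
  ∑-0 (x ∷ xs) = ∑-0 xs

  ∑-swap : ∀ (xs : List A) (ys : List B) (f : A → B → ℕ) →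
    (∑[ x ∈ xs ] ∑[ y ∈ ys ] f x y) ≡ (∑[ y ∈ ys ] ∑[ x ∈ xs ] f x y)
  ∑-swap []       ys f = sym (∑-0 ys)
  ∑-swap (x ∷ xs) ys f = trans (cong (∑ ys (f x) +_) (∑-swap xs ys f))
    (sym (∑-+ ys (f x) λ y → ∑[ x ∈ xs ] f x y))

  ∑-++ : ∀ (xs ys : List A) f → ∑ (xs ++ ys) f ≡ ∑ xs f + ∑ ys f
  ∑-++ []       ys f = refl
  ∑-++ (x ∷ xs) ys f = trans (cong (f x +_) (∑-++ xs ys f)) (sym (ℕ.+-assoc (f x) _ _))

  ∑-map : ∀ (g : A → B) (xs : List A) f → ∑ (map g xs) f ≡ ∑ xs (f ∘ g)
  ∑-map g xs f = cong sum (sym (map-∘ xs))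

  ∑-cartesianProductWith : ∀ (g : A → B → C) xs ys f →
    ∑ (cartesianProductWith g xs ys) f ≡ (∑[ x ∈ xs ] ∑[ y ∈ ys ] f (g x y))
  ∑-cartesianProductWith g []       ys f = refl
  ∑-cartesianProductWith g (x ∷ xs) ys f = trans (∑-++ (map (g x) ys) _ f)
    (cong₂ _+_ (∑-map (g x) ys f) (∑-cartesianProductWith g xs ys f))

  length-filter≡∑ : ∀ {P : Pred A _} (P? : Decidable P) xs → length (filter P? xs) ≡ (∑[ x ∈ xs ] ⟦ P? x ⟧)
  length-filter≡∑ P? []       = refl
  length-filter≡∑ P? (x ∷ xs) with P? x
  ... | yes _ = cong suc (length-filter≡∑ P? xs)
  ... | no  _ = length-filter≡∑ P? xs

  -- Completeness and absence of repetitions are one numerical equation, `once`, so that both pass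
  -- to products and vectors by computing with sums.
  record Enumeration (A : Set) : Set where
    field
      _≟_      : DecidableEquality A
      elements : List A
      once     : ∀ a → (∑[ x ∈ elements ] ⟦ x ≟ a ⟧) ≡ 1

    ∑-select : ∀ a f → (∑[ x ∈ elements ] ⟦ x ≟ a ⟧ * f x) ≡ f a
    ∑-select a f = begin
      (∑[ x ∈ elements ] ⟦ x ≟ a ⟧ * f x)  ≡⟨ (∑-cong elements λ x → ⟦⟧*-cong (x ≟ a) (cong f)) ⟩
      (∑[ x ∈ elements ] ⟦ x ≟ a ⟧ * f a)  ≡⟨ ∑-*ʳ elements (f a) _ ⟩
      (∑[ x ∈ elements ] ⟦ x ≟ a ⟧) * f a  ≡⟨ cong (_* f a) (once a) ⟩
      1 * f a                              ≡⟨ ℕ.*-identityˡ (f a) ⟩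
      f a                                  ∎
      where open ≡-Reasoning

    ∑-*-once : ∀ m a → (∑[ x ∈ elements ] m * ⟦ x ≟ a ⟧) ≡ m
    ∑-*-once m a = trans (∑-*ˡ elements m _) (trans (cong (m *_) (once a)) (ℕ.*-identityʳ m))

  open Enumeration using (elements; once)

  -- Both counts equal the number of pairs (x , y) on the graph of the bijection.
  ∑-bijection : ∀ (EA : Enumeration A) (EB : Enumeration B)
    {P : Pred A _} {Q : Pred B _} (P? : Decidable P) (Q? : Decidable Q) (φ : A → B) (ψ : B → A) →
    (∀ x y → (P x × y ≡ φ x) ⇔ (Q y × x ≡ ψ y)) →
    (∑[ x ∈ elements EA ] ⟦ P? x ⟧) ≡ (∑[ y ∈ elements EB ] ⟦ Q? y ⟧)
  ∑-bijection EA EB P? Q? φ ψ φ⇔ψ = begin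
    (∑[ x ∈ xs ] ⟦ P? x ⟧)
      ≡⟨ (∑-cong xs λ x → B.∑-*-once ⟦ P? x ⟧ (φ x)) ⟨
    (∑[ x ∈ xs ] ∑[ y ∈ ys ] ⟦ P? x ⟧ * ⟦ y B.≟ φ x ⟧)
      ≡⟨ (∑-cong xs λ x → ∑-cong ys λ y → trans (sym (⟦⟧-× (P? x) (y B.≟ φ x)))
           (trans (⟦⟧-cong (P? x ×-dec y B.≟ φ x) (Q? y ×-dec x A.≟ ψ y) (φ⇔ψ x y)) (⟦⟧-× (Q? y) (x A.≟ ψ y)))) ⟩
    (∑[ x ∈ xs ] ∑[ y ∈ ys ] ⟦ Q? y ⟧ * ⟦ x A.≟ ψ y ⟧)
      ≡⟨ ∑-swap xs ys (λ x y → ⟦ Q? y ⟧ * ⟦ x A.≟ ψ y ⟧) ⟩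
    (∑[ y ∈ ys ] ∑[ x ∈ xs ] ⟦ Q? y ⟧ * ⟦ x A.≟ ψ y ⟧)
      ≡⟨ (∑-cong ys λ y → A.∑-*-once ⟦ Q? y ⟧ (ψ y)) ⟩
    (∑[ y ∈ ys ] ⟦ Q? y ⟧) ∎
    where
    open ≡-Reasoning
    module A = Enumeration EA
    module B = Enumeration EB
    xs = elements EA
    ys = elements EB

  productWith : ∀ (EA : Enumeration A) (EB : Enumeration B) (_≟_ : DecidableEquality C) (g : A → B → C) →
    (∀ {x x′ y y′} → g x y ≡ g x′ y′ → x ≡ x′ × y ≡ y′) → (∀ z → ∃ λ x → ∃ λ y → z ≡ g x y) →
    Enumeration C
  productWith EA EB _≟_ g inj surj = record
    { _≟_ = _≟_ ; elements = cartesianProductWith g xs ys ; once = once′ }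
    where
    open ≡-Reasoning
    module A = Enumeration EA
    module B = Enumeration EB
    xs = elements EA
    ys = elements EB
    once′ : ∀ c → (∑[ z ∈ cartesianProductWith g xs ys ] ⟦ z ≟ c ⟧) ≡ 1
    once′ c with surj c
    ... | a , b , refl = begin
      (∑[ z ∈ cartesianProductWith g xs ys ] ⟦ z ≟ g a b ⟧)
        ≡⟨ ∑-cartesianProductWith g xs ys _ ⟩
      (∑[ x ∈ xs ] ∑[ y ∈ ys ] ⟦ g x y ≟ g a b ⟧)
        ≡⟨ (∑-cong xs λ x → ∑-cong ys λ y → trans
             (⟦⟧-cong (g x y ≟ g a b) (x A.≟ a ×-dec y B.≟ b) (mk⇔ inj λ (p , q) → cong₂ g p q))
             (⟦⟧-× (x A.≟ a) (y B.≟ b))) ⟩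
      (∑[ x ∈ xs ] ∑[ y ∈ ys ] ⟦ x A.≟ a ⟧ * ⟦ y B.≟ b ⟧)
        ≡⟨ (∑-cong xs λ x → B.∑-*-once ⟦ x A.≟ a ⟧ b) ⟩
      (∑[ x ∈ xs ] ⟦ x A.≟ a ⟧)
        ≡⟨ once EA a ⟩
      1 ∎

  ∑-allFin-suc : ∀ n f → ∑ (allFin (suc n)) f ≡ f Fin.zero + ∑ (allFin n) (f ∘ Fin.suc)
  ∑-allFin-suc n f = cong (f Fin.zero +_)
    (trans (cong (λ xs → ∑ xs f) (sym (map-tabulate (λ i → i) Fin.suc))) (∑-map Fin.suc (allFin n) f))

  ∑-allFin-1 : ∀ n → (∑[ _ ∈ allFin n ] 1) ≡ n
  ∑-allFin-1 zero    = refl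
  ∑-allFin-1 (suc n) = trans (∑-allFin-suc n λ _ → 1) (cong suc (∑-allFin-1 n))

  fins : ∀ n → Enumeration (Fin n)
  fins n = record { _≟_ = Fin._≟_ ; elements = allFin n ; once = once′ n }
    where
    once′ : ∀ n a → (∑[ i ∈ allFin n ] ⟦ i Fin.≟ a ⟧) ≡ 1
    once′ (suc n) Fin.zero = trans (∑-allFin-suc n λ i → ⟦ i Fin.≟ Fin.zero ⟧) (cong suc
      (trans (∑-cong (allFin n) λ i → ⟦⟧-no (Fin.suc i Fin.≟ Fin.zero) λ ()) (∑-0 (allFin n))))
    once′ (suc n) (Fin.suc a) = trans (∑-allFin-suc n λ i → ⟦ i Fin.≟ Fin.suc a ⟧) (trans
      (∑-cong (allFin n) λ i → ⟦⟧-cong (Fin.suc i Fin.≟ Fin.suc a) (i Fin.≟ a) (mk⇔ Fin.suc-injective (cong Fin.suc)))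
      (once′ n a))

  pairs : Enumeration A → Enumeration B → Enumeration (A × B)
  pairs EA EB = productWith EA EB (Product.≡-dec (Enumeration._≟_ EA) (Enumeration._≟_ EB)) _,_
    (λ e → cong proj₁ e , cong proj₂ e) (λ (x , y) → x , y , refl)

  vecs : Enumeration A → ∀ m → Enumeration (Vec A m)
  vecs EA m = record { _≟_ = _≟ᵛ_ ; elements = allVecs (elements EA) m ; once = once′ m }
    where
    _≟ᵛ_ : ∀ {m} → DecidableEquality (Vec _ m)
    _≟ᵛ_ = Vec.≡-dec (Enumeration._≟_ EA)
    once′ : ∀ m a → (∑[ v ∈ allVecs (elements EA) m ] ⟦ v ≟ᵛ a ⟧) ≡ 1
    once′ zero    [] = refl
    once′ (suc m) = once (productWith EA
      (record { _≟_ = _≟ᵛ_ ; elements = allVecs (elements EA) m ; once = once′ m }) _≟ᵛ_ _∷_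
      Vec.∷-injective λ { (x ∷ v) → x , v , refl })

  -- Vectors with distinct entries

  Distinct : Vec A m → Set
  Distinct []      = ⊤
  Distinct (x ∷ v) = x ∉ᵛ v × Distinct v

  infix 4 _∈ᵛ?_ _≟ᵛ_

  _∈ᵛ?_ : (x : Fin n) (v : Vec (Fin n) m) → Dec (x ∈ᵛ v)
  x ∈ᵛ? v = DecMembership._∈?_ Fin._≟_ x v

  _≟ᵛ_ : DecidableEquality (Vec (Fin n) m)
  _≟ᵛ_ = Vec.≡-dec Fin._≟_

  distinct? : (v : Vec (Fin n) m) → Dec (Distinct v)
  distinct? []      = yes tt
  distinct? (x ∷ v) = ¬? (x ∈ᵛ? v) ×-dec distinct? v

  distinct-map⁻ : ∀ (h : A → B) (v : Vec A m) → Distinct (Vec.map h v) → Distinct v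
  distinct-map⁻ h []      _         = tt
  distinct-map⁻ h (x ∷ v) (hx∉ , d) = hx∉ ∘ ∈-map⁺ h , distinct-map⁻ h v d

  ⟦¬⟧+⟦⟧ : ∀ {P : Set} (d : Dec P) → ⟦ ¬? d ⟧ + ⟦ d ⟧ ≡ 1
  ⟦¬⟧+⟦⟧ (yes _) = refl
  ⟦¬⟧+⟦⟧ (no  _) = refl

  ∑-∈ᵛ : ∀ (v : Vec (Fin n) m) → Distinct v → (∑[ x ∈ allFin n ] ⟦ x ∈ᵛ? v ⟧) ≡ m
  ∑-∈ᵛ {n} []      _       = ∑-0 (allFin n)
  ∑-∈ᵛ {n} {suc m} (y ∷ v) (y∉v , d) = begin
    (∑[ x ∈ allFin n ] ⟦ x ∈ᵛ? y ∷ v ⟧)                      ≡⟨ ∑-cong (allFin n) split ⟩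
    (∑[ x ∈ allFin n ] ⟦ x Fin.≟ y ⟧ + ⟦ x ∈ᵛ? v ⟧)          ≡⟨ ∑-+ (allFin n) _ _ ⟩
    (∑[ x ∈ allFin n ] ⟦ x Fin.≟ y ⟧) + (∑[ x ∈ allFin n ] ⟦ x ∈ᵛ? v ⟧)  ≡⟨ cong₂ _+_ (once (fins n) y) (∑-∈ᵛ v d) ⟩
    suc m ∎
    where
    open ≡-Reasoning
    split : ∀ x → ⟦ x ∈ᵛ? y ∷ v ⟧ ≡ ⟦ x Fin.≟ y ⟧ + ⟦ x ∈ᵛ? v ⟧
    split x with x Fin.≟ y
    ... | yes refl = cong suc (sym (⟦⟧-no (y ∈ᵛ? v) y∉v))
    ... | no  _    = refl

  arrangements : (n m : ℕ) → ℕ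
  arrangements n m = ∑[ v ∈ allVecs (allFin n) m ] ⟦ distinct? v ⟧

  -- A vector of `m` distinct entries has `n - m` admissible new heads; the subtraction is moved to
  -- the left, so that the identity holds in the naturals for every `m`, even beyond `n`.
  arrangements-suc : ∀ n m → arrangements n (suc m) + m * arrangements n m ≡ n * arrangements n m
  arrangements-suc n m = begin
    arrangements n (suc m) + m * arrangements n m
      ≡⟨ cong₂ _+_ (trans (∑-cartesianProductWith _∷_ (allFin n) vs _)
           (∑-swap (allFin n) vs (λ x v → ⟦ distinct? (x ∷ v) ⟧))) (sym (∑-*ˡ vs m _)) ⟩
    (∑[ v ∈ vs ] ∑[ x ∈ allFin n ] ⟦ distinct? (x ∷ v) ⟧) + (∑[ v ∈ vs ] m * ⟦ distinct? v ⟧)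
      ≡⟨ ∑-+ vs _ _ ⟨
    (∑[ v ∈ vs ] (∑[ x ∈ allFin n ] ⟦ distinct? (x ∷ v) ⟧) + m * ⟦ distinct? v ⟧)
      ≡⟨ ∑-cong vs extend ⟩
    (∑[ v ∈ vs ] n * ⟦ distinct? v ⟧)
      ≡⟨ ∑-*ˡ vs n _ ⟩
    n * arrangements n m ∎
    where
    open ≡-Reasoning
    vs = allVecs (allFin n) m
    extend : ∀ v → (∑[ x ∈ allFin n ] ⟦ distinct? (x ∷ v) ⟧) + m * ⟦ distinct? v ⟧ ≡ n * ⟦ distinct? v ⟧
    extend v with distinct? v
    ... | no ¬d = trans
      (cong₂ _+_
        (trans
          (∑-cong (allFin n) λ x → trans (⟦⟧-× (¬? (x ∈ᵛ? v)) (no ¬d)) (ℕ.*-zeroʳ ⟦ ¬? (x ∈ᵛ? v) ⟧))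
          (∑-0 (allFin n)))
        (ℕ.*-zeroʳ m))
      (sym (ℕ.*-zeroʳ n))
    ... | yes d = begin
      (∑[ x ∈ allFin n ] ⟦ ¬? (x ∈ᵛ? v) ×-dec yes d ⟧) + m * 1
        ≡⟨ cong₂ _+_ (∑-cong (allFin n) λ x → trans (⟦⟧-× (¬? (x ∈ᵛ? v)) (yes d)) (ℕ.*-identityʳ _))
             (trans (ℕ.*-identityʳ m) (sym (∑-∈ᵛ v d))) ⟩
      (∑[ x ∈ allFin n ] ⟦ ¬? (x ∈ᵛ? v) ⟧) + (∑[ x ∈ allFin n ] ⟦ x ∈ᵛ? v ⟧)
        ≡⟨ ∑-+ (allFin n) _ _ ⟨
      (∑[ x ∈ allFin n ] ⟦ ¬? (x ∈ᵛ? v) ⟧ + ⟦ x ∈ᵛ? v ⟧)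
        ≡⟨ (∑-cong (allFin n) λ x → ⟦¬⟧+⟦⟧ (x ∈ᵛ? v)) ⟩
      (∑[ _ ∈ allFin n ] 1)
        ≡⟨ trans (∑-allFin-1 n) (sym (ℕ.*-identityʳ n)) ⟩
      n * 1 ∎

  -- Random tuples acting on vectors of distinct points

  ∑-allVecs-1 : ∀ (xs : List A) m → (∑[ _ ∈ allVecs xs m ] 1) ≡ (∑[ _ ∈ xs ] 1) ^ m
  ∑-allVecs-1 xs zero    = refl
  ∑-allVecs-1 xs (suc m) = begin
    (∑[ _ ∈ allVecs xs (suc m) ] 1)            ≡⟨ ∑-cartesianProductWith _∷_ xs (allVecs xs m) _ ⟩
    (∑[ _ ∈ xs ] (∑[ _ ∈ allVecs xs m ] 1))    ≡⟨ (∑-cong xs λ _ → sym (ℕ.*-identityˡ _)) ⟩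
    (∑[ _ ∈ xs ] 1 * (∑[ _ ∈ allVecs xs m ] 1))  ≡⟨ ∑-*ʳ xs _ (λ _ → 1) ⟩
    (∑[ _ ∈ xs ] 1) * (∑[ _ ∈ allVecs xs m ] 1)  ≡⟨ cong ((∑[ _ ∈ xs ] 1) *_) (∑-allVecs-1 xs m) ⟩
    (∑[ _ ∈ xs ] 1) ^ suc m ∎
    where open ≡-Reasoning

  map-lookup-≔ : ∀ (f : Vec A n) {x} z (s : Vec (Fin n) m) → x ∉ᵛ s →
    Vec.map (lookup (f [ x ]≔ z)) s ≡ Vec.map (lookup f) s
  map-lookup-≔ f z []      _   = refl
  map-lookup-≔ f z (y ∷ s) x∉ = cong₂ _∷_
    (Vec.lookup∘updateAt′ y _ (λ e → x∉ (here (sym e))) f) (map-lookup-≔ f z s (x∉ ∘ there))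

  module _ (n : ℕ) where

    functions : List (Vec (Fin n) n)
    functions = allVecs (allFin n) n

    -- A function with the value `y` at `x`, together with a free value `z`, amounts to a function
    -- unconstrained at `x`: write `z` at `x`, or read the value off and put `y` back. As `x` is not
    -- in `s`, the rest of the constraint survives, so each entry of `s` costs one factor `n`.
    ∑-map-lookup : ∀ (s t : Vec (Fin n) m) → Distinct s →
      n ^ m * (∑[ f ∈ functions ] ⟦ Vec.map (lookup f) s ≟ᵛ t ⟧) ≡ n ^ n
    ∑-map-lookup [] [] _ = begin
      1 * (∑[ f ∈ functions ] 1)  ≡⟨ ℕ.*-identityˡ _ ⟩
      (∑[ f ∈ functions ] 1)      ≡⟨ ∑-allVecs-1 (allFin n) n ⟩
      (∑[ f ∈ allFin n ] 1) ^ n   ≡⟨ cong (_^ n) (∑-allFin-1 n) ⟩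
      n ^ n                       ∎
      where open ≡-Reasoning
    ∑-map-lookup {suc m} (x ∷ s) (y ∷ t) (x∉s , d) = begin
      n * n ^ m * (∑[ f ∈ functions ] ⟦ Vec.map (lookup f) (x ∷ s) ≟ᵛ y ∷ t ⟧)
        ≡⟨ solve 3 (λ a b c → a :* b :* c := b :* (c :* a)) refl n (n ^ m) _ ⟩
      n ^ m * ((∑[ f ∈ functions ] ⟦ Vec.map (lookup f) (x ∷ s) ≟ᵛ y ∷ t ⟧) * n)
        ≡⟨ cong (n ^ m *_) (trans (sym (∑-*ʳ functions n _)) (∑-cong functions λ f →
             trans (cong (⟦ Vec.map (lookup f) (x ∷ s) ≟ᵛ y ∷ t ⟧ *_) (sym (∑-allFin-1 n))) (sym (const f)))) ⟩
      n ^ m * (∑[ f ∈ functions ] ∑[ _ ∈ allFin n ] ⟦ Vec.map (lookup f) (x ∷ s) ≟ᵛ y ∷ t ⟧)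
        ≡⟨ cong (n ^ m *_) (∑-cartesianProductWith _,_ functions (allFin n)
             (λ (f , _) → ⟦ Vec.map (lookup f) (x ∷ s) ≟ᵛ y ∷ t ⟧)) ⟨
      n ^ m * (∑[ p ∈ cartesianProduct functions (allFin n) ] ⟦ Vec.map (lookup (proj₁ p)) (x ∷ s) ≟ᵛ y ∷ t ⟧)
        ≡⟨ cong (n ^ m *_) (∑-bijection (pairs (vecs (fins n) n) (fins n)) (vecs (fins n) n)
             (λ (f , _) → Vec.map (lookup f) (x ∷ s) ≟ᵛ y ∷ t) (λ f → Vec.map (lookup f) s ≟ᵛ t)
             (λ (f , z) → f [ x ]≔ z) (λ f → f [ x ]≔ y , lookup f x)
             λ p h → mk⇔ (to p h) (from p h)) ⟩
      n ^ m * (∑[ f ∈ functions ] ⟦ Vec.map (lookup f) s ≟ᵛ t ⟧)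
        ≡⟨ ∑-map-lookup s t d ⟩
      n ^ n ∎
      where
      open ≡-Reasoning
      const : ∀ f → (∑[ _ ∈ allFin n ] ⟦ Vec.map (lookup f) (x ∷ s) ≟ᵛ y ∷ t ⟧)
        ≡ ⟦ Vec.map (lookup f) (x ∷ s) ≟ᵛ y ∷ t ⟧ * (∑[ _ ∈ allFin n ] 1)
      const f = trans (∑-cong (allFin n) λ _ → sym (ℕ.*-identityʳ _))
        (∑-*ˡ (allFin n) ⟦ Vec.map (lookup f) (x ∷ s) ≟ᵛ y ∷ t ⟧ λ _ → 1)
      to : ∀ p h → Vec.map (lookup (proj₁ p)) (x ∷ s) ≡ y ∷ t × h ≡ proj₁ p [ x ]≔ proj₂ p →
        Vec.map (lookup h) s ≡ t × p ≡ (h [ x ]≔ y , lookup h x)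
      to (f , z) _ (e , refl) = trans (map-lookup-≔ f z s x∉s) (Vec.∷-injectiveʳ e) , cong₂ _,_
        (sym (trans (Vec.[]≔-idempotent f x) (trans (cong (f [ x ]≔_) (sym (Vec.∷-injectiveˡ e))) (Vec.[]≔-lookup f x))))
        (sym (Vec.lookup∘updateAt x f))
      from : ∀ p h → Vec.map (lookup h) s ≡ t × p ≡ (h [ x ]≔ y , lookup h x) →
        Vec.map (lookup (proj₁ p)) (x ∷ s) ≡ y ∷ t × h ≡ proj₁ p [ x ]≔ proj₂ p
      from _ h (e , refl) = cong₂ _∷_ (Vec.lookup∘updateAt x h) (trans (map-lookup-≔ h y s x∉s) e) ,
        sym (trans (Vec.[]≔-idempotent h x) (Vec.[]≔-lookup h x))

    -- Grouping the functions by the vector map (lookup f) s that they take on s.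
    ∑-functions : ∀ (s : Vec (Fin n) m) → Distinct s → ∀ H →
      n ^ m * (∑[ f ∈ functions ] H (Vec.map (lookup f) s)) ≡ n ^ n * ∑ (allVecs (allFin n) m) H
    ∑-functions {m} s d H = begin
      n ^ m * (∑[ f ∈ functions ] H (Vec.map (lookup f) s))
        ≡⟨ cong (n ^ m *_) (∑-cong functions λ f → sym (Enumeration.∑-select (vecs (fins n) m) (Vec.map (lookup f) s) H)) ⟩
      n ^ m * (∑[ f ∈ functions ] ∑[ u ∈ us ] ⟦ u ≟ᵛ Vec.map (lookup f) s ⟧ * H u)
        ≡⟨ cong (n ^ m *_) (∑-swap functions us λ f u → ⟦ u ≟ᵛ Vec.map (lookup f) s ⟧ * H u) ⟩
      n ^ m * (∑[ u ∈ us ] ∑[ f ∈ functions ] ⟦ u ≟ᵛ Vec.map (lookup f) s ⟧ * H u)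
        ≡⟨ ∑-*ˡ us (n ^ m) _ ⟨
      (∑[ u ∈ us ] n ^ m * (∑[ f ∈ functions ] ⟦ u ≟ᵛ Vec.map (lookup f) s ⟧ * H u))
        ≡⟨ (∑-cong us λ u → begin
          n ^ m * (∑[ f ∈ functions ] ⟦ u ≟ᵛ Vec.map (lookup f) s ⟧ * H u)
            ≡⟨ cong (n ^ m *_) (∑-*ʳ functions (H u) _) ⟩
          n ^ m * ((∑[ f ∈ functions ] ⟦ u ≟ᵛ Vec.map (lookup f) s ⟧) * H u)
            ≡⟨ cong (λ z → n ^ m * (z * H u)) (∑-cong functions λ f →
                 ⟦⟧-cong (u ≟ᵛ Vec.map (lookup f) s) (Vec.map (lookup f) s ≟ᵛ u) (mk⇔ sym sym)) ⟩
          n ^ m * ((∑[ f ∈ functions ] ⟦ Vec.map (lookup f) s ≟ᵛ u ⟧) * H u)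
            ≡⟨ ℕ.*-assoc (n ^ m) _ (H u) ⟨
          n ^ m * (∑[ f ∈ functions ] ⟦ Vec.map (lookup f) s ≟ᵛ u ⟧) * H u
            ≡⟨ cong (_* H u) (∑-map-lookup s u d) ⟩
          n ^ n * H u ∎) ⟩
      (∑[ u ∈ us ] n ^ n * H u)
        ≡⟨ ∑-*ˡ us (n ^ n) H ⟩
      n ^ n * ∑ us H ∎
      where
      open ≡-Reasoning
      us = allVecs (allFin n) m

    module _ {m : ℕ} where
      private us = allVecs (allFin n) m

      transfers : ∀ k (s t : Vec (Fin n) m) → ℕ
      transfers k s t = ∑[ fs ∈ allTuples k n ] ⟦ Vec.map (composite fs) s ≟ᵛ t ⟧

      transfers-suc : ∀ k s t → transfers (suc k) s t ≡ (∑[ f ∈ functions ] transfers k (Vec.map (lookup f) s) t)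
      transfers-suc k s t = trans (∑-cartesianProductWith _∷_ functions (allTuples k n) _)
        (∑-cong functions λ f → ∑-cong (allTuples k n) λ fs →
          cong (λ v → ⟦ v ≟ᵛ t ⟧) (Vec.map-∘ (composite fs) (lookup f) s))

      -- Only a distinct vector can be mapped to a distinct one. The sum over all sources may thus
      -- be restricted to distinct `s`, where `∑-functions` applies.
      transfers-distinct : ∀ k s t → Distinct t → ⟦ distinct? s ⟧ * transfers k s t ≡ transfers k s t
      transfers-distinct k s t d = trans (sym (∑-*ˡ (allTuples k n) ⟦ distinct? s ⟧ _)) (∑-cong (allTuples k n) lem)
        where
        lem : ∀ fs → ⟦ distinct? s ⟧ * ⟦ Vec.map (composite fs) s ≟ᵛ t ⟧ ≡ ⟦ Vec.map (composite fs) s ≟ᵛ t ⟧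
        lem fs with Vec.map (composite fs) s ≟ᵛ t
        ... | yes e = cong (_* 1) (⟦⟧-yes (distinct? s) (distinct-map⁻ (composite fs) s (subst Distinct (sym e) d)))
        ... | no  _    = ℕ.*-zeroʳ ⟦ distinct? s ⟧

      -- A recursion with both ends fixed does not close, since the first function can send `s`
      -- anywhere. It closes once the source is summed over: a uniform function sends a distinct `s`
      -- to a uniform vector, so `transferSuc` hands the whole sum over sources to `transfersInto`,
      -- where the sum over distinct `s` contributes `arrangements n m`.
      transfersInto : ∀ k t → Distinct t →
        (n ^ m) ^ k * (∑[ s ∈ us ] transfers k s t) ≡ (n ^ n * arrangements n m) ^ k
      transferSuc : ∀ k s t → Distinct s → Distinct t →
        (n ^ m) ^ suc k * transfers (suc k) s t ≡ n ^ n * (n ^ n * arrangements n m) ^ k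

      transfersInto zero    t d = trans (ℕ.*-identityˡ _) (trans
        (∑-cong us λ s → trans (ℕ.+-identityʳ _) (cong (λ v → ⟦ v ≟ᵛ t ⟧) (Vec.map-id s)))
        (once (vecs (fins n) m) t))
      transfersInto (suc k) t d = begin
        (n ^ m) ^ suc k * (∑[ s ∈ us ] transfers (suc k) s t)
          ≡⟨ ∑-*ˡ us ((n ^ m) ^ suc k) _ ⟨
        (∑[ s ∈ us ] (n ^ m) ^ suc k * transfers (suc k) s t)
          ≡⟨ ∑-cong us step ⟩
        (∑[ s ∈ us ] ⟦ distinct? s ⟧ * (n ^ n * (n ^ n * arrangements n m) ^ k))
          ≡⟨ ∑-*ʳ us _ _ ⟩
        arrangements n m * (n ^ n * (n ^ n * arrangements n m) ^ k)
          ≡⟨ solve 3 (λ a b c → a :* (b :* c) := b :* a :* c) refl (arrangements n m) (n ^ n) _ ⟩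
        (n ^ n * arrangements n m) ^ suc k ∎
        where
        open ≡-Reasoning
        step : ∀ s → (n ^ m) ^ suc k * transfers (suc k) s t ≡ ⟦ distinct? s ⟧ * (n ^ n * (n ^ n * arrangements n m) ^ k)
        step s = trans (cong ((n ^ m) ^ suc k *_) (sym (transfers-distinct (suc k) s t d)))
          (trans
            (solve 3 (λ a b c → a :* (b :* c) := b :* (a :* c)) refl
              ((n ^ m) ^ suc k) ⟦ distinct? s ⟧ (transfers (suc k) s t))
            (⟦⟧*-cong (distinct? s) λ d′ → transferSuc k s t d′ d))

      transferSuc k s t ds dt = begin
        n ^ m * (n ^ m) ^ k * transfers (suc k) s t
          ≡⟨ solve 3 (λ a b c → a :* b :* c := b :* (a :* c)) refl (n ^ m) ((n ^ m) ^ k) _ ⟩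
        (n ^ m) ^ k * (n ^ m * transfers (suc k) s t)
          ≡⟨ cong (λ z → (n ^ m) ^ k * (n ^ m * z)) (transfers-suc k s t) ⟩
        (n ^ m) ^ k * (n ^ m * (∑[ f ∈ functions ] transfers k (Vec.map (lookup f) s) t))
          ≡⟨ cong ((n ^ m) ^ k *_) (∑-functions s ds λ u → transfers k u t) ⟩
        (n ^ m) ^ k * (n ^ n * (∑[ u ∈ us ] transfers k u t))
          ≡⟨ solve 3 (λ a b c → a :* (b :* c) := b :* (a :* c)) refl ((n ^ m) ^ k) (n ^ n) _ ⟩
        n ^ n * ((n ^ m) ^ k * (∑[ u ∈ us ] transfers k u t))
          ≡⟨ cong (n ^ n *_) (transfersInto k t dt) ⟩
        n ^ n * (n ^ n * arrangements n m) ^ k ∎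
        where
        open ≡-Reasoning

      -- The count in `transferSuc` is the same for all distinct ends, so the target may vary with
      -- the source; `rotate` and `rotateTail` are the two uses.
      ∑-conjugacies : ∀ k (r : Vec (Fin n) m → Vec (Fin n) m) → (∀ s → Distinct s → Distinct (r s)) →
        (n ^ m) ^ suc k * (∑[ fs ∈ allTuples (suc k) n ] ∑[ s ∈ us ] ⟦ distinct? s ×-dec Vec.map (composite fs) s ≟ᵛ r s ⟧)
          ≡ (n ^ n * arrangements n m) ^ suc k
      ∑-conjugacies k r r-distinct = begin
        (n ^ m) ^ suc k * (∑[ fs ∈ allTuples (suc k) n ] ∑[ s ∈ us ] ⟦ distinct? s ×-dec Vec.map (composite fs) s ≟ᵛ r s ⟧)
          ≡⟨ cong ((n ^ m) ^ suc k *_) (trans (∑-swap (allTuples (suc k) n) us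
               (λ fs s → ⟦ distinct? s ×-dec Vec.map (composite fs) s ≟ᵛ r s ⟧))
               (∑-cong us λ s → trans (∑-cong (allTuples (suc k) n) λ fs → ⟦⟧-× (distinct? s) (Vec.map (composite fs) s ≟ᵛ r s))
                 (∑-*ˡ (allTuples (suc k) n) ⟦ distinct? s ⟧ _))) ⟩
        (n ^ m) ^ suc k * (∑[ s ∈ us ] ⟦ distinct? s ⟧ * transfers (suc k) s (r s))
          ≡⟨ trans (sym (∑-*ˡ us ((n ^ m) ^ suc k) _)) (∑-cong us λ s → trans
               (solve 3 (λ a b c → a :* (b :* c) := b :* (a :* c)) refl
                 ((n ^ m) ^ suc k) ⟦ distinct? s ⟧ (transfers (suc k) s (r s)))
               (⟦⟧*-cong (distinct? s) λ d → transferSuc k s (r s) d (r-distinct s d))) ⟩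
        (∑[ s ∈ us ] ⟦ distinct? s ⟧ * (n ^ n * (n ^ n * arrangements n m) ^ k))
          ≡⟨ ∑-*ʳ us _ _ ⟩
        arrangements n m * (n ^ n * (n ^ n * arrangements n m) ^ k)
          ≡⟨ solve 3 (λ a b c → a :* (b :* c) := b :* a :* c) refl (arrangements n m) (n ^ n) _ ⟩
        (n ^ n * arrangements n m) ^ suc k ∎
        where
        open ≡-Reasoning

  -- The core of a self-map

  injective⇒surjective : ∀ {f : Fin n → Fin n} → Injective _≡_ _≡_ f → ∀ y → ∃ λ x → f x ≡ y
  injective⇒surjective {suc n} {f} inj y with Fin.any? (λ x → f x Fin.≟ y)
  ... | yes hit = hit
  ... | no miss = contradiction (Fin.injective⇒≤ {f = λ x → punchOut (miss ∘ (x ,_) ∘ sym)}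
    λ {x} {x′} e → inj (Fin.punchOut-injective (miss ∘ (x ,_) ∘ sym) (miss ∘ (x′ ,_) ∘ sym) e)) ℕ.1+n≰n

  -- The iterated images are constant from the exponent suc n on, by Stabilization.limit.
  core : (Fin n → Fin n) → Subset n
  core {n} g = Stabilization.I g (suc n)

  module _ (g : Fin n → Fin n) where

    iterate-∈-core : ∀ x → iterate g x (suc n) ∈ core g
    iterate-∈-core = ∈-image⁺ λ x → iterate g x (suc n)

    core-onto : ∀ {y} → y ∈ core g → ∃[ z ] z ∈ core g × g z ≡ y
    core-onto {y} y∈ with ∈-image⁻ (λ x → iterate g x (2 + n)) (subst (y ∈_) (sym (Stabilization.stable g)) y∈)
    ... | x , refl = iterate g x (suc n) , iterate-∈-core x , sym (iterate-suc g x (suc n))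

    module _ (P : Fin n → Set) (onto : ∀ {y} → P y → ∃[ z ] P z × g z ≡ y) where

      iterate-onto : ∀ m {y} → P y → ∃[ z ] P z × iterate g z m ≡ y
      iterate-onto zero    {y} py = y , py , refl
      iterate-onto (suc m) py with iterate-onto m py
      ... | z , pz , refl with onto pz
      ... | w , pw , refl = w , pw , refl

      -- Stepping back `suc n` times inside `P` exhibits `y` as an iterated image. The core is thus
      -- the largest set covered by its own image, which captures cycles and fixed points alike.
      onto⇒∈core : ∀ {y} → P y → y ∈ core g
      onto⇒∈core py with iterate-onto (suc n) py
      ... | z , _ , refl = iterate-∈-core z

    core-closed : ∀ {x} → x ∈ core g → g x ∈ core g
    core-closed {x} x∈ = onto⇒∈core (λ y → ∃[ z ] z ∈ core g × g z ≡ y)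
      (λ (z , z∈ , e) → z , core-onto z∈ , e) (x , x∈ , refl)

    -- A surjection of the finite core onto itself is injective. To argue on all of `Fin n`, a right
    -- inverse of `g` on the core is extended by the identity to `section`; this is injective, hence
    -- surjective, and so a left inverse of `g` on the core as well.
    core-injective : ∀ {x y} → x ∈ core g → y ∈ core g → g x ≡ g y → x ≡ y
    core-injective x∈ y∈ gx≡gy = trans (sym (section-g x∈)) (trans (cong section gx≡gy) (section-g y∈))
      where
      choose : ∀ y → Dec (y ∈ core g) → Fin n
      choose y (yes y∈) = proj₁ (core-onto y∈)
      choose y (no  _)  = y
      section : Fin n → Fin n
      section y = choose y (y ∈? core g)
      choose-injective : ∀ y z p q → choose y p ≡ choose z q → y ≡ z
      choose-injective y z (yes y∈) (yes z∈) e =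
        trans (sym (proj₂ (proj₂ (core-onto y∈)))) (trans (cong g e) (proj₂ (proj₂ (core-onto z∈))))
      choose-injective y z (yes y∈) (no  z∉) e =
        contradiction (subst (_∈ core g) e (proj₁ (proj₂ (core-onto y∈)))) z∉
      choose-injective y z (no  y∉) (yes z∈) e =
        contradiction (subst (_∈ core g) (sym e) (proj₁ (proj₂ (core-onto z∈)))) y∉
      choose-injective y z (no  y∉) (no  z∉) e = e
      g-choose : ∀ y p → choose y p ∈ core g → g (choose y p) ≡ y
      g-choose y (yes y∈) _  = proj₂ (proj₂ (core-onto y∈))
      g-choose y (no  y∉) y∈ = contradiction y∈ y∉
      section-g : ∀ {x} → x ∈ core g → section (g x) ≡ x
      section-g {x} x∈
        with y , e ← injective⇒surjective {f = section} (λ {y} {z} → choose-injective y z (y ∈? core g) (z ∈? core g)) x =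
        trans (cong section (trans (cong g (sym e)) (g-choose y (y ∈? core g) (subst (_∈ core g) (sym e) x∈)))) e

    -- Each core element has an `M`-fold preimage, so absorption puts it into `D`. The criterion
    -- does not mention the exponent `suc n`, which makes it usable for a modified map.
    core-unique : ∀ (D : Subset n) M → (∀ x → iterate g x M ∈ D) → (∀ {y} → y ∈ D → ∃[ z ] z ∈ D × g z ≡ y) →
      core g ≡ D
    core-unique D M absorbs onto = ⊆-antisym core⊆D (onto⇒∈core (_∈ D) onto)
      where
      core⊆D : core g ⊆ D
      core⊆D y∈ with iterate-onto (_∈ core g) core-onto M y∈
      ... | z , _ , refl = absorbs z

  -- Inside the core `σ` is a permutation, so `h` still maps the core onto itself; outside, `h` and
  -- `g` agree, so `h` is absorbed too.
  core-∘ : ∀ (g h : Fin n → Fin n) (σ : Fin n → Fin n) → (∀ x → σ (σ x) ≡ x) → (∀ x → h x ≡ g (σ x)) →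
    (∀ {x} → x ∈ core g → σ x ∈ core g) → (∀ {x} → x ∉ core g → σ x ≡ x) → core h ≡ core g
  core-∘ {n} g h σ σσ h≗gσ σ∈ σ∉ = core-unique h (core g) (suc n) absorbs onto
    where
    h-closed : ∀ {x} → x ∈ core g → h x ∈ core g
    h-closed {x} x∈ = subst (_∈ core g) (sym (h≗gσ x)) (core-closed g (σ∈ x∈))
    iterate-closed : ∀ m {x} → x ∈ core g → iterate h x m ∈ core g
    iterate-closed zero    x∈ = x∈
    iterate-closed (suc m) x∈ = iterate-closed m (h-closed x∈)
    agree : ∀ m x → iterate g x m ∈ core g → iterate h x m ∈ core g
    agree zero    x p = p
    -- The trajectories under `g` and `h` coincide until the first visit to the core, after which
    -- `h` cannot leave it.
    agree (suc m) x p with x ∈? core g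
    ... | yes x∈ = iterate-closed (suc m) x∈
    ... | no  x∉ = subst (λ y → iterate h y m ∈ core g) (sym (trans (h≗gσ x) (cong g (σ∉ x∉)))) (agree m (g x) p)
    absorbs : ∀ x → iterate h x (suc n) ∈ core g
    absorbs x = agree (suc n) x (iterate-∈-core g x)
    onto : ∀ {y} → y ∈ core g → ∃[ z ] z ∈ core g × h z ≡ y
    onto y∈ with core-onto g y∈
    ... | z , z∈ , refl = σ z , σ∈ z∈ , trans (h≗gσ (σ z)) (cong g (σσ z))

  -- Twisting a tuple by a transposition

  transpose-ˡ : ∀ (i j : Fin n) → transpose i j i ≡ j
  transpose-ˡ i j with i Fin.≟ i
  ... | yes _  = refl
  ... | no i≢i = contradiction refl i≢i

  transpose-ʳ : ∀ (i j : Fin n) → transpose i j j ≡ i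
  transpose-ʳ i j with j Fin.≟ i
  ... | yes j≡i = j≡i
  ... | no  _ with j Fin.≟ j
  ...   | yes _  = refl
  ...   | no j≢j = contradiction refl j≢j

  transpose-fixes : ∀ {i j k : Fin n} → k ≢ i → k ≢ j → transpose i j k ≡ k
  transpose-fixes {i = i} {j} {k} k≢i k≢j with k Fin.≟ i
  ... | yes k≡i = contradiction k≡i k≢i
  ... | no  _ with k Fin.≟ j
  ...   | yes k≡j = contradiction k≡j k≢j
  ...   | no  _   = refl

  transpose-involutive : ∀ (i j k : Fin n) → transpose i j (transpose i j k) ≡ k
  transpose-involutive i j k = helper (k Fin.≟ i) (k Fin.≟ j)
    where
    helper : Dec (k ≡ i) → Dec (k ≡ j) → transpose i j (transpose i j k) ≡ k
    helper (yes refl) _          = trans (cong (transpose i j) (transpose-ˡ i j)) (transpose-ʳ i j)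
    helper (no _)     (yes refl) = trans (cong (transpose i j) (transpose-ʳ i j)) (transpose-ˡ i j)
    helper (no k≢i)   (no k≢j)   = trans (cong (transpose i j) (transpose-fixes k≢i k≢j)) (transpose-fixes k≢i k≢j)

  core-∘-transpose : ∀ (g h : Fin n → Fin n) {i j} → i ∈ core g → j ∈ core g →
    (∀ x → h x ≡ g (transpose i j x)) → core h ≡ core g
  core-∘-transpose g h {i} {j} i∈ j∈ h≗ = core-∘ g h (transpose i j) (transpose-involutive i j) h≗ σ∈
    (λ {x} x∉ → transpose-fixes (λ { refl → x∉ i∈ }) λ { refl → x∉ j∈ })
    where
    σ∈ : ∀ {x} → x ∈ core g → transpose i j x ∈ core g
    σ∈ {x} x∈ = helper (x Fin.≟ i) (x Fin.≟ j)
      where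
      helper : Dec (x ≡ i) → Dec (x ≡ j) → transpose i j x ∈ core g
      helper (yes refl) _          = subst (_∈ core g) (sym (transpose-ˡ i j)) j∈
      helper (no _)     (yes refl) = subst (_∈ core g) (sym (transpose-ʳ i j)) i∈
      helper (no x≢i)   (no x≢j)   = subst (_∈ core g) (sym (transpose-fixes x≢i x≢j)) x∈

  -- Changing the first function alone already turns the composite `g` into `g ∘ σ`; this needs a
  -- nonempty tuple.
  precompose : (Fin n → Fin n) → Tuple (suc k) n → Tuple (suc k) n
  precompose σ (f ∷ fs) = tabulate (lookup f ∘ σ) ∷ fs

  composite-precompose : ∀ σ (fs : Tuple (suc k) n) x → composite (precompose σ fs) x ≡ composite fs (σ x)
  composite-precompose σ (f ∷ fs) x = cong (composite fs) (Vec.lookup∘tabulate (lookup f ∘ σ) x)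

  precompose-involutive : ∀ {σ} → (∀ x → σ (σ x) ≡ x) → ∀ (fs : Tuple (suc k) n) → precompose σ (precompose σ fs) ≡ fs
  precompose-involutive {σ = σ} σσ (f ∷ fs) = cong (_∷ fs) (trans
    (Vec.tabulate-cong λ x → trans (Vec.lookup∘tabulate (lookup f ∘ σ) (σ x)) (cong (lookup f) (σσ x)))
    (Vec.tabulate∘lookup f))

  -- Cycles written as rotated vectors

  rotate : Vec A m → Vec A m
  rotate []      = []
  rotate (x ∷ v) = v ∷ʳ x

  map-rotate : ∀ (h : A → B) (v : Vec A m) → Vec.map h (rotate v) ≡ rotate (Vec.map h v)
  map-rotate h []      = refl
  map-rotate h (x ∷ v) = Vec.map-∷ʳ h x v

  ∈-∷ʳ⁻ : ∀ {x y : A} (v : Vec A m) → y ∈ᵛ v ∷ʳ x → y ∈ᵛ x ∷ v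
  ∈-∷ʳ⁻ []      y∈         = y∈
  ∈-∷ʳ⁻ (z ∷ v) (here e)   = there (here e)
  ∈-∷ʳ⁻ (z ∷ v) (there y∈) with ∈-∷ʳ⁻ v y∈
  ... | here e   = here e
  ... | there y∈ = there (there y∈)

  ∈-∷ʳ⁺ : ∀ {x y : A} (v : Vec A m) → y ∈ᵛ x ∷ v → y ∈ᵛ v ∷ʳ x
  ∈-∷ʳ⁺ []      y∈                 = y∈
  ∈-∷ʳ⁺ (z ∷ v) (here e)           = there (∈-∷ʳ⁺ v (here e))
  ∈-∷ʳ⁺ (z ∷ v) (there (here e))   = here e
  ∈-∷ʳ⁺ (z ∷ v) (there (there y∈)) = there (∈-∷ʳ⁺ v (there y∈))

  ∈-rotate⁺ : ∀ {y : A} (v : Vec A m) → y ∈ᵛ v → y ∈ᵛ rotate v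
  ∈-rotate⁺ (x ∷ v) = ∈-∷ʳ⁺ v

  ∈-rotate⁻ : ∀ {y : A} (v : Vec A m) → y ∈ᵛ rotate v → y ∈ᵛ v
  ∈-rotate⁻ (x ∷ v) = ∈-∷ʳ⁻ v

  distinct-∷ʳ : ∀ {x : A} (v : Vec A m) → x ∉ᵛ v → Distinct v → Distinct (v ∷ʳ x)
  distinct-∷ʳ []      x∉ _         = x∉ , tt
  distinct-∷ʳ (y ∷ v) x∉ (y∉v , d) =
    (λ y∈ → case ∈-∷ʳ⁻ v y∈ of λ { (here e) → x∉ (here (sym e)) ; (there y∈v) → y∉v y∈v }) ,
    distinct-∷ʳ v (x∉ ∘ there) d

  distinct-rotate : ∀ (v : Vec A m) → Distinct v → Distinct (rotate v)
  distinct-rotate []      _        = tt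
  distinct-rotate (x ∷ v) (x∉ , d) = distinct-∷ʳ v x∉ d

  -- Cycle notation as a single vector equation, the form that `∑-conjugacies` counts.
  Cyclic : (Fin n → Fin n) → Vec (Fin n) m → Set
  Cyclic g s = Distinct s × Vec.map g s ≡ rotate s

  cyclic? : ∀ (g : Fin n → Fin n) (s : Vec (Fin n) m) → Dec (Cyclic g s)
  cyclic? g s = distinct? s ×-dec Vec.map g s ≟ᵛ rotate s

  Outsider : Subset n → Vec (Fin n) m → Set
  Outsider C s = ∃[ x ] x ∈ C × x ∉ᵛ s

  outsider? : ∀ (C : Subset n) (s : Vec (Fin n) m) → Dec (Outsider C s)
  outsider? C s = Fin.any? λ x → x ∈? C ×-dec ¬? (x ∈ᵛ? s)

  ∈-map⁻ : ∀ (h : A → B) (v : Vec A m) {y} → y ∈ᵛ Vec.map h v → ∃[ x ] x ∈ᵛ v × h x ≡ y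
  ∈-map⁻ h (x ∷ v) (here refl) = x , here refl , refl
  ∈-map⁻ h (x ∷ v) (there y∈) with ∈-map⁻ h v y∈
  ... | z , z∈ , e = z , there z∈ , e

  cyclic-onto : ∀ (g : Fin n → Fin n) {s : Vec (Fin n) m} → Cyclic g s →
    ∀ {y} → y ∈ᵛ s → ∃[ x ] x ∈ᵛ s × g x ≡ y
  cyclic-onto g {s} (_ , e) y∈ = ∈-map⁻ g s (subst (_ ∈ᵛ_) (sym e) (∈-rotate⁺ s y∈))

  cyclic⇒∈core : ∀ (g : Fin n → Fin n) {s : Vec (Fin n) m} → Cyclic g s → ∀ {y} → y ∈ᵛ s → y ∈ core g
  cyclic⇒∈core g {s} c = onto⇒∈core g (_∈ᵛ s) (cyclic-onto g c)

  -- An entry of `s` already has a preimage in `s`, and `g` is injective on the core, so a second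
  -- preimage off `s` is impossible.
  outsider-image : ∀ (g : Fin n → Fin n) {s : Vec (Fin n) m} → Cyclic g s →
    ∀ {x} → x ∈ core g → x ∉ᵛ s → g x ∉ᵛ s
  outsider-image g {s} c x∈ x∉ gx∈ with cyclic-onto g c gx∈
  ... | z , z∈ , e = x∉ (subst (_∈ᵛ s) (core-injective g (cyclic⇒∈core g c z∈) x∈ e) z∈)

  map-cong-∈ : ∀ {f h : A → B} (v : Vec A m) → (∀ {x} → x ∈ᵛ v → f x ≡ h x) → Vec.map f v ≡ Vec.map h v
  map-cong-∈ []      e = refl
  map-cong-∈ (x ∷ v) e = cong₂ _∷_ (e (here refl)) (map-cong-∈ v (e ∘ there))

  -- Junk value Vec.head s if s exhausts C.
  pick : Subset n → Vec (Fin n) (suc m) → Fin n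
  pick C s with outsider? C s
  ... | yes (x , _) = x
  ... | no  _       = Vec.head s

  pick-outsider : ∀ (C : Subset n) (s : Vec (Fin n) (suc m)) → Outsider C s → pick C s ∈ C × pick C s ∉ᵛ s
  pick-outsider C s o with outsider? C s
  ... | yes (_ , x) = x
  ... | no  ¬o      = contradiction o ¬o

  -- With the marked point `x` in front of `s`, the target vector for a map that fixes `x` and
  -- rotates `s`.
  rotateTail : Vec A m → Vec A m
  rotateTail []      = []
  rotateTail (x ∷ v) = x ∷ rotate v

  distinct-rotateTail : ∀ (v : Vec A m) → Distinct v → Distinct (rotateTail v)
  distinct-rotateTail []      _        = tt
  distinct-rotateTail (x ∷ v) (x∉ , d) = x∉ ∘ ∈-rotate⁻ v , distinct-rotate v d

  -- The bijection with marked fixed points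

  module _ (n m k : ℕ) where
    private
      Config Config⁺ : Set
      Config  = Tuple (suc k) n × Vec (Fin n) (suc m)
      Config⁺ = Tuple (suc k) n × Vec (Fin n) (suc (suc m))

      Larger : Config → Set
      Larger (fs , s) = Cyclic (composite fs) s × Outsider (core (composite fs)) s

      Fixed : Config⁺ → Set
      Fixed (fs , s) = Distinct s × Vec.map (composite fs) s ≡ rotateTail s

      -- With c the chosen element of core ∖ s and x = g c, precomposing g with the
      -- transposition (c x) makes x a fixed point and leaves s and the core unchanged.
      toFixed : Config → Config⁺
      toFixed (fs , s) = precompose (transpose c x) fs , x ∷ s
        where
        c = pick (core (composite fs)) s
        x = composite fs c

      toLarger : Config⁺ → Config
      toLarger (fs , x ∷ s) = precompose (transpose (pick (core (composite fs)) s) x) fs , s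

      -- Common to both directions, which use the same transposition: the twist exchanges the images
      -- of `c` and `x` and touches neither the cycle nor the core.
      module Twist (fs : Tuple (suc k) n) {s : Vec (Fin n) (suc m)} (cyc : Cyclic (composite fs) s)
        {c x : Fin n} (c∈ : c ∈ core (composite fs)) (c∉ : c ∉ᵛ s) (x∈ : x ∈ core (composite fs)) (x∉ : x ∉ᵛ s) where

        fs′ = precompose (transpose c x) fs

        core≡ : core (composite fs′) ≡ core (composite fs)
        core≡ = core-∘-transpose (composite fs) (composite fs′) c∈ x∈ (composite-precompose (transpose c x) fs)

        cyc′ : Cyclic (composite fs′) s
        cyc′ = proj₁ cyc , trans (map-cong-∈ s λ {y} y∈ → trans (composite-precompose (transpose c x) fs y)
          (cong (composite fs) (transpose-fixes (λ { refl → c∉ y∈ }) λ { refl → x∉ y∈ }))) (proj₂ cyc)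

        composite-c : composite fs′ c ≡ composite fs x
        composite-c = trans (composite-precompose (transpose c x) fs c) (cong (composite fs) (transpose-ˡ c x))

        composite-x : composite fs′ x ≡ composite fs c
        composite-x = trans (composite-precompose (transpose c x) fs x) (cong (composite fs) (transpose-ʳ c x))

        untwist : precompose (transpose c x) fs′ ≡ fs
        untwist = precompose-involutive (transpose-involutive c x) fs

      larger⇒fixed : ∀ p → Larger p → Fixed (toFixed p) × p ≡ toLarger (toFixed p)
      larger⇒fixed (fs , s) (cyc , o) =
        ((x∉ , proj₁ cyc) , cong₂ _∷_ T.composite-x (proj₂ T.cyc′)) ,
        -- The core is unchanged, so `pick` returns the same `c` and the second twist cancels the
        -- first.
        cong (_, s) (sym (trans (cong (λ C → precompose (transpose (pick C s) x) T.fs′) T.core≡) T.untwist))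
        where
        g = composite fs
        c = pick (core g) s
        x = g c
        c∈ = proj₁ (pick-outsider (core g) s o)
        c∉ = proj₂ (pick-outsider (core g) s o)
        x∉ = outsider-image g cyc c∈ c∉
        module T = Twist fs cyc c∈ c∉ (core-closed g c∈) x∉

      fixed⇒larger : ∀ q → Fixed q → Larger (toLarger q) × q ≡ toFixed (toLarger q)
      fixed⇒larger (fs , x ∷ s) ((x∉ , d) , e) =
        (T.cyc′ , c , subst (c ∈_) (sym T.core≡) c∈ , c∉) ,
        cong₂ (λ gs z → gs , z ∷ s)
          (sym (trans (cong₂ (λ c′ x′ → precompose (transpose c′ x′) T.fs′) c′≡c x′≡x) T.untwist))
          (sym x′≡x)
        where
        g = composite fs
        gx≡x = Vec.∷-injectiveˡ e
        cyc : Cyclic g s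
        cyc = d , Vec.∷-injectiveʳ e
        x∈ : x ∈ core g
        x∈ = onto⇒∈core g (_≡ x) (λ { refl → x , refl , gx≡x }) refl
        c = pick (core g) s
        c∈ = proj₁ (pick-outsider (core g) s (x , x∈ , x∉))
        c∉ = proj₂ (pick-outsider (core g) s (x , x∈ , x∉))
        module T = Twist fs cyc c∈ c∉ x∈ x∉
        c′≡c : pick (core (composite T.fs′)) s ≡ c
        c′≡c = cong (λ C → pick C s) T.core≡
        -- Since `x` was fixed, the twist makes it the image of `c`, so `toFixed` recovers the pair
        -- `c`, `x`.
        x′≡x : composite T.fs′ (pick (core (composite T.fs′)) s) ≡ x
        x′≡x = trans (cong (composite T.fs′) c′≡c) (trans T.composite-c gx≡x)

    ∑-larger≡∑-fixed :
      (∑[ fs ∈ allTuples (suc k) n ] ∑[ s ∈ allVecs (allFin n) (suc m) ]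
        ⟦ cyclic? (composite fs) s ×-dec outsider? (core (composite fs)) s ⟧)
      ≡ (∑[ fs ∈ allTuples (suc k) n ] ∑[ s ∈ allVecs (allFin n) (suc (suc m)) ]
        ⟦ distinct? s ×-dec Vec.map (composite fs) s ≟ᵛ rotateTail s ⟧)
    ∑-larger≡∑-fixed = trans (sym (∑-cartesianProductWith _,_ (elements tuples) (elements (vs (suc m))) (⟦_⟧ ∘ larger?)))
      (trans (∑-bijection (pairs tuples (vs (suc m))) (pairs tuples (vs (suc (suc m)))) larger? fixed? toFixed toLarger
        λ p q → mk⇔ (λ { (h , refl) → larger⇒fixed p h }) (λ { (h , refl) → fixed⇒larger q h }))
      (∑-cartesianProductWith _,_ (elements tuples) (elements (vs (suc (suc m)))) (⟦_⟧ ∘ fixed?)))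
      where
      vs = vecs (fins n)
      tuples : Enumeration (Tuple (suc k) n)
      tuples = vecs (vs n) (suc k)
      larger? : ∀ p → Dec (Larger p)
      larger? (fs , s) = cyclic? (composite fs) s ×-dec outsider? (core (composite fs)) s
      fixed? : ∀ p → Dec (Fixed p)
      fixed? (fs , s) = distinct? s ×-dec Vec.map (composite fs) s ≟ᵛ rotateTail s

  -- Eventually cyclic tuples and spanning cycles

  lookup-∷ʳ-inject₁ : ∀ (v : Vec A m) x i → lookup (v ∷ʳ x) (inject₁ i) ≡ lookup v i
  lookup-∷ʳ-inject₁ (y ∷ v) x Fin.zero    = refl
  lookup-∷ʳ-inject₁ (y ∷ v) x (Fin.suc i) = lookup-∷ʳ-inject₁ v x i

  lookup-∷ʳ-fromℕ : ∀ (v : Vec A m) x → lookup (v ∷ʳ x) (fromℕ m) ≡ x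
  lookup-∷ʳ-fromℕ []      x = refl
  lookup-∷ʳ-fromℕ (y ∷ v) x = lookup-∷ʳ-fromℕ v x

  suc-mod-inject₁ : ∀ (i : Fin m) → suc (toℕ (inject₁ i)) mod suc m ≡ Fin.suc i
  suc-mod-inject₁ {m} i = Fin.toℕ-injective (trans (Fin.toℕ-fromℕ< _)
    (trans (cong (λ j → suc j % suc m) (Fin.toℕ-inject₁ i)) (m<n⇒m%n≡m (ℕ.s≤s (Fin.toℕ<n i)))))

  suc-mod-fromℕ : ∀ m → suc (toℕ (fromℕ m)) mod suc m ≡ Fin.zero
  suc-mod-fromℕ m = Fin.toℕ-injective (trans (Fin.toℕ-fromℕ< _)
    (trans (cong (λ j → suc j % suc m) (Fin.toℕ-fromℕ m)) (n%n≡0 (suc m))))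

  lookup-rotate : ∀ (v : Vec A (suc m)) i → lookup (rotate v) i ≡ lookup v (suc (toℕ i) mod suc m)
  lookup-rotate {m = m} (x ∷ v) i with view i
  ... | ‵fromℕ     = trans (lookup-∷ʳ-fromℕ v x) (cong (lookup (x ∷ v)) (sym (suc-mod-fromℕ m)))
  ... | ‵inject₁ j = trans (lookup-∷ʳ-inject₁ v x j) (cong (lookup (x ∷ v)) (sym (suc-mod-inject₁ j)))

  distinct-tabulate : ∀ {f : Fin m → A} → Injective _≡_ _≡_ f → Distinct (tabulate f)
  distinct-tabulate {m = zero}  inj = tt
  distinct-tabulate {m = suc m} inj =
    (λ f0∈ → case Any.tabulate⁻ f0∈ of λ (i , e) → case inj e of λ ()) , distinct-tabulate (Fin.suc-injective ∘ inj)

  lookup-injective : ∀ (v : Vec A m) → Distinct v → Injective _≡_ _≡_ (lookup v)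
  lookup-injective (x ∷ v) _        {Fin.zero}  {Fin.zero}  e = refl
  lookup-injective (x ∷ v) (x∉ , _) {Fin.zero}  {Fin.suc j} e = contradiction (subst (_∈ᵛ v) (sym e) (∈-lookup j v)) x∉
  lookup-injective (x ∷ v) (x∉ , _) {Fin.suc i} {Fin.zero}  e = contradiction (subst (_∈ᵛ v) e (∈-lookup i v)) x∉
  lookup-injective (x ∷ v) (_ , d)  {Fin.suc i} {Fin.suc j} e = cong Fin.suc (lookup-injective v d e)

  ∣∣≡∑ : ∀ (S : Subset n) → ∣ S ∣ ≡ (∑[ x ∈ allFin n ] ⟦ x ∈? S ⟧)
  ∣∣≡∑ []            = refl
  ∣∣≡∑ {suc n} (true ∷ S)  = trans (cong suc (∣∣≡∑ S)) (sym (∑-allFin-suc n λ x → ⟦ x ∈? true ∷ S ⟧))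
  ∣∣≡∑ {suc n} (false ∷ S) = trans (∣∣≡∑ S) (sym (∑-allFin-suc n λ x → ⟦ x ∈? false ∷ S ⟧))

  Spanning : (Fin n → Fin n) → Vec (Fin n) m → Set
  Spanning g s = Cyclic g s × (∀ {x} → x ∈ core g → x ∈ᵛ s)

  ∑-core : ∀ (g : Fin n → Fin n) {s : Vec (Fin n) m} → Spanning g s → (∑[ x ∈ allFin n ] ⟦ x ∈? core g ⟧) ≡ m
  ∑-core {n} g {s} (cyc , spans) = trans
    (∑-cong (allFin n) λ x → ⟦⟧-cong (x ∈? core g) (x ∈ᵛ? s) (mk⇔ spans (cyclic⇒∈core g cyc)))
    (∑-∈ᵛ s (proj₁ cyc))

  spanning-rotate : ∀ (g : Fin n → Fin n) (s : Vec (Fin n) m) → Spanning g s → Spanning g (rotate s)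
  spanning-rotate g s ((d , e) , spans) =
    (distinct-rotate s d , trans (map-rotate g s) (cong rotate e)) , ∈-rotate⁺ s ∘ spans

  head-rotate : ∀ (g : A → A) (s : Vec A (suc m)) → Vec.map g s ≡ rotate s → Vec.head (rotate s) ≡ g (Vec.head s)
  head-rotate g (x ∷ s) e = cong Vec.head (sym e)

  -- The closing entry `y` is kept free, because the tail of a rotated vector does not close up with
  -- its own head.
  orbit-∷ʳ : ∀ (g : A → A) x y (s : Vec A m) → Vec.map g (x ∷ s) ≡ s ∷ʳ y → x ∷ s ≡ Vec.iterate g x (suc m)
  orbit-∷ʳ g x y []      e = refl
  orbit-∷ʳ g x y (z ∷ s) e with Vec.∷-injective e
  ... | refl , e′ = cong (x ∷_) (orbit-∷ʳ g z y s e′)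

  rotation⇒orbit : ∀ (g : A → A) (s : Vec A (suc m)) → Vec.map g s ≡ rotate s → s ≡ Vec.iterate g (Vec.head s) (suc m)
  rotation⇒orbit g (x ∷ s) = orbit-∷ʳ g x x s

  ∈-iterate⁻ : ∀ (g : A → A) x m {y} → y ∈ᵛ Vec.iterate g x m → ∃[ i ] y ≡ iterate g x i
  ∈-iterate⁻ g x (suc m) (here e)   = 0 , e
  ∈-iterate⁻ g x (suc m) (there y∈) with ∈-iterate⁻ g (g x) m y∈
  ... | i , e = suc i , e

  spanning-iterate : ∀ (g : Fin n → Fin n) i (s : Vec (Fin n) (suc m)) → Spanning g s →
    ∃ λ (t : Vec (Fin n) (suc m)) → Spanning g t × Vec.head t ≡ iterate g (Vec.head s) i
  spanning-iterate g zero    s sp = s , sp , refl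
  spanning-iterate g (suc i) s sp with spanning-iterate g i (rotate s) (spanning-rotate g s sp)
  ... | t , sp′ , e = t , sp′ , trans e (cong (λ x → iterate g x i) (head-rotate g s (proj₂ (proj₁ sp))))

  -- Every core element is an iterate of the head, and each rotation advances the head by one
  -- iterate, so the cycle can be rewritten to start at `x`.
  ∈-core⇒spanning-iterate : ∀ (g : Fin n → Fin n) {s : Vec (Fin n) (suc m)} → Spanning g s →
    ∀ {x} → x ∈ core g → Spanning g (Vec.iterate g x (suc m))
  ∈-core⇒spanning-iterate {m = m} g {s} sp@((_ , e) , spans) {x} x∈
    with ∈-iterate⁻ g (Vec.head s) (suc m) (subst (x ∈ᵛ_) (rotation⇒orbit g s e) (spans x∈))
  ... | i , refl with spanning-iterate g i s sp
  ... | t , sp′@((_ , e′) , _) , h =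
    subst (Spanning g) (trans (rotation⇒orbit g t e′) (cong (λ y → Vec.iterate g y (suc m)) h)) sp′

  -- Built from `cyclic?` and the negated `outsider?`, so that its indicator is by computation the
  -- one that `⟦×¬⟧+⟦×⟧` splits off.
  spanning? : ∀ (g : Fin n → Fin n) (s : Vec (Fin n) m) → Dec (Spanning g s)
  spanning? g s = map′
    (λ (c , ¬o) → c , λ {x} x∈ → decidable-stable (x ∈ᵛ? s) λ x∉ → ¬o (x , x∈ , x∉))
    (λ (c , spans) → c , λ (x , x∈ , x∉) → x∉ (spans x∈))
    (cyclic? g s ×-dec ¬? (outsider? (core g) s))

  -- `Vec.head` is a bijection onto the core: the cycle can start at any of its `suc m` elements,
  -- and the start determines the rest.
  ∑-spanning : ∀ (g : Fin n → Fin n) {s : Vec (Fin n) (suc m)} → Spanning g s →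
    (∑[ t ∈ allVecs (allFin n) (suc m) ] ⟦ spanning? g t ⟧) ≡ suc m
  ∑-spanning {n} {m} g sp = trans
    (∑-bijection (vecs (fins n) (suc m)) (fins n) (spanning? g) (_∈? core g) Vec.head (λ x → Vec.iterate g x (suc m))
      λ t x → mk⇔
        (λ { (sp′@((d , e) , _) , refl) → cyclic⇒∈core g (d , e) (head∈ t) , rotation⇒orbit g t e })
        (λ { (x∈ , refl) → ∈-core⇒spanning-iterate g sp x∈ , refl }))
    (∑-core g sp)
    where
    head∈ : ∀ (t : Vec (Fin n) (suc m)) → Vec.head t ∈ᵛ t
    head∈ (x ∷ t) = here refl

  module _ {k : ℕ} (fs : Tuple k n) where
    private g = composite fs

    eventuallyCyclic⇒spanning : EventuallyCyclic (suc m) fs → ∃[ s ] Spanning {m = suc m} g s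
    eventuallyCyclic⇒spanning {m} (S , stable , _ , s , inj , enumerates , step) =
      tabulate s , (distinct-tabulate inj , (begin
        Vec.map g (tabulate s)                        ≡⟨ Vec.tabulate-∘ g s ⟨
        tabulate (g ∘ s)                              ≡⟨ Vec.tabulate-cong (λ i → trans (step i)
                                                           (trans (sym (Vec.lookup∘tabulate s _)) (sym (lookup-rotate (tabulate s) i)))) ⟩
        tabulate (lookup (rotate (tabulate s)))       ≡⟨ Vec.tabulate∘lookup _ ⟩
        rotate (tabulate s)                           ∎)) ,
      λ {x} x∈ → case Equivalence.to (enumerates x) (subst (x ∈_) core≡S x∈) of λ { (i , refl) → ∈-tabulate⁺ s i }
      where
      open ≡-Reasoning
      core≡S : core g ≡ S
      core≡S = Stabilization.unique g (Stabilization.stabilizesTo g) stable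

    spanning⇒eventuallyCyclic : ∀ {s} → Spanning {m = suc m} g s → EventuallyCyclic (suc m) fs
    spanning⇒eventuallyCyclic {m} {s} sp@((d , e) , spans) =
      core g , Stabilization.stabilizesTo g , trans (∣∣≡∑ (core g)) (∑-core g sp) ,
      lookup s , lookup-injective s d ,
      (λ x → mk⇔ (λ x∈ → Any.index (spans x∈) , sym (Any.lookup-index (spans x∈)))
                 (λ { (i , refl) → cyclic⇒∈core g (d , e) (∈-lookup i s) })) ,
      λ i → trans (sym (Vec.lookup-map i g s)) (trans (cong (λ v → lookup v i) e) (lookup-rotate s i))

    ∑-spanning≡* : ∀ m (d : Dec (EventuallyCyclic (suc m) fs)) →
      (∑[ s ∈ allVecs (allFin n) (suc m) ] ⟦ spanning? g s ⟧) ≡ suc m * ⟦ d ⟧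
    ∑-spanning≡* m (yes ev) = trans (∑-spanning g (proj₂ (eventuallyCyclic⇒spanning ev))) (sym (ℕ.*-identityʳ (suc m)))
    ∑-spanning≡* m (no ¬ev) = trans
      (trans (∑-cong vs λ s → ⟦⟧-no (spanning? g s) (¬ev ∘ spanning⇒eventuallyCyclic)) (∑-0 vs))
      (sym (ℕ.*-zeroʳ m))
      where vs = allVecs (allFin n) (suc m)

  -- The counting identity

  ⟦×¬⟧+⟦×⟧ : ∀ {P Q : Set} (p : Dec P) (q : Dec Q) → ⟦ p ×-dec ¬? q ⟧ + ⟦ p ×-dec q ⟧ ≡ ⟦ p ⟧
  ⟦×¬⟧+⟦×⟧ (no _)  q       = refl
  ⟦×¬⟧+⟦×⟧ (yes _) (yes _) = refl
  ⟦×¬⟧+⟦×⟧ (yes _) (no _)  = refl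

  cyclicTuples : (k N n : ℕ) .{{_ : ℕ.NonZero N}} → ℕ
  cyclicTuples k N n = length (filter (eventuallyCyclic? N) (allTuples k n))

  conjugacies : (k n m : ℕ) → (Vec (Fin n) m → Vec (Fin n) m) → ℕ
  conjugacies k n m r = ∑[ fs ∈ allTuples k n ] ∑[ s ∈ allVecs (allFin n) m ]
    ⟦ distinct? s ×-dec Vec.map (composite fs) s ≟ᵛ r s ⟧

  cyclicTuples-conjugacies : ∀ k m n →
    suc m * cyclicTuples (suc k) (suc m) n + conjugacies (suc k) n (suc (suc m)) rotateTail
      ≡ conjugacies (suc k) n (suc m) rotate
  cyclicTuples-conjugacies k m n = begin
    suc m * cyclicTuples (suc k) (suc m) n + conjugacies (suc k) n (suc (suc m)) rotateTail
      ≡⟨ cong₂ _+_ (trans (cong (suc m *_) (length-filter≡∑ (eventuallyCyclic? (suc m)) fss)) (sym (∑-*ˡ fss (suc m) _)))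
           (sym (∑-larger≡∑-fixed n m k)) ⟩
    (∑[ fs ∈ fss ] suc m * ⟦ eventuallyCyclic? (suc m) fs ⟧) +
    (∑[ fs ∈ fss ] ∑ vs (larger fs))
      ≡⟨ ∑-+ fss _ _ ⟨
    (∑[ fs ∈ fss ] suc m * ⟦ eventuallyCyclic? (suc m) fs ⟧ +
      ∑ vs (larger fs))
      -- For one tuple, the cyclic vectors split into the spanning ones, `suc m` or none, and those
      -- with an outsider.
      ≡⟨ (∑-cong fss λ fs → trans (cong (_+ ∑ vs (larger fs)) (sym (∑-spanning≡* fs m (eventuallyCyclic? (suc m) fs))))
           (trans (sym (∑-+ vs _ (larger fs)))
             (∑-cong vs λ s → ⟦×¬⟧+⟦×⟧ (cyclic? (composite fs) s) (outsider? (core (composite fs)) s)))) ⟩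
    conjugacies (suc k) n (suc m) rotate ∎
    where
    open ≡-Reasoning
    fss = allTuples (suc k) n
    vs  = allVecs (allFin n) (suc m)
    larger : Tuple (suc k) n → Vec (Fin n) (suc m) → ℕ
    larger fs s = ⟦ cyclic? (composite fs) s ×-dec outsider? (core (composite fs)) s ⟧

module Asymptotics where

  open Counting
  open import Algebra.Bundles using (CommutativeRing)
  open import Algebra.Properties.CommutativeSemiring.Exp
    (CommutativeRing.commutativeSemiring ℚ.+-*-commutativeRing) using (_^_; ^-assocʳ; ^-distrib-*)
  open import Data.Integer.Base as ℤ using (+_)
  import Data.Integer.Properties as ℤ
  open import Data.Nat.Base as ℕ using (ℕ; zero; suc; NonZero; z≤n; s≤s; _!)
  open import Data.Nat.Combinatorics using (_C_; nC1≡n; nCk+nC[k+1]≡[n+1]C[k+1])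
  open import Data.Rational.Base
    using (ℚ; 0ℚ; 1ℚ; ½; _+_; _*_; _-_; -_; _≤_; _<_; _/_; ∣_∣; nonNegative)
  import Data.Rational.Solver as ℚ
  open import Data.Rational.Unnormalised.Base as ℚᵘ using ()
  import Data.Rational.Unnormalised.Properties as ℚᵘ
  open import Data.Sum.Base using (inj₁; inj₂)
  open import Relation.Nullary using (yes; no)
  open ℚ.+-*-Solver using (solve; _:+_; _:*_; _:-_; :-_; _:=_; con)

  -- The exact formula for the probability

  inv : (n : ℕ) .{{_ : NonZero n}} → ℚ
  inv n = + 1 / n

  /≡ι*inv : ∀ a n .{{_ : NonZero n}} → + a / n ≡ ι a * inv n
  /≡ι*inv a (suc d) = sym (trans (/-*-/ (+ a) (+ 1) 0 d)
    (ℚ./-cong (ℤ.*-identityʳ (+ a)) (ℕ.+-identityʳ (suc d))))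

  ι*inv : ∀ n .{{_ : NonZero n}} → ι n * inv n ≡ 1ℚ
  ι*inv n@(suc d) = trans (sym (/≡ι*inv n n))
    (ℚ.toℚᵘ-injective (ℚᵘ.≃-trans (toℚᵘ-/ (+ n) d) (ℚᵘ.*≡* (ℤ.*-comm (+ n) (+ 1)))))

  ι-cancelˡ : ∀ n .{{_ : NonZero n}} {x y} → ι n * x ≡ ι n * y → x ≡ y
  ι-cancelˡ n {x} {y} e = trans (sym (drop x)) (trans (cong (inv n *_) e) (drop y))
    where
    drop : ∀ z → inv n * (ι n * z) ≡ z
    drop z = trans (solve 3 (λ v m z → v :* (m :* z) := m :* v :* z) refl (inv n) (ι n) z)
      (trans (cong (_* z) (ι*inv n)) (ℚ.*-identityˡ z))

  ι-+ : ∀ a b → ι (a ℕ.+ b) ≡ ι a + ι b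
  ι-+ zero    b = sym (ℚ.+-identityˡ (ι b))
  ι-+ (suc a) b = trans (ι-suc (a ℕ.+ b)) (trans (cong (λ z → 1ℚ + z) (ι-+ a b))
    (trans (sym (ℚ.+-assoc 1ℚ (ι a) (ι b))) (cong (_+ ι b) (sym (ι-suc a)))))

  ι-^ : ∀ a k → ι (a ℕ.^ k) ≡ ι a ^ k
  ι-^ a zero    = refl
  ι-^ a (suc k) = trans (ι-* a (a ℕ.^ k)) (cong (ι a *_) (ι-^ a k))

  -- ρ (1 / n) m is n(n-1)⋯(n-m+1) / nᵐ; it vanishes for m > n, as it has a factor 1 - n/n.
  ρ : ℚ → ℕ → ℚ
  ρ v zero    = 1ℚ
  ρ v (suc i) = ρ v i * (1ℚ - ι i * v)

  module _ (n : ℕ) .{{_ : NonZero n}} where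
    private v = inv n

    ι-arrangements : ∀ m → ι (arrangements n m) ≡ ι (n ℕ.^ m) * ρ v m
    ι-arrangements zero    = refl
    ι-arrangements (suc m) = begin
      ι (arrangements n (suc m))
        ≡⟨ solve 2 (λ x y → x := (x :+ y) :- y) refl (ι (arrangements n (suc m))) (ι m * D) ⟩
      (ι (arrangements n (suc m)) + ι m * D) - ι m * D
        ≡⟨ cong (_- ι m * D) (trans (cong (λ z → ι (arrangements n (suc m)) + z) (sym (ι-* m (arrangements n m))))
             (trans (sym (ι-+ (arrangements n (suc m)) _)) (trans (cong ι (arrangements-suc n m)) (ι-* n (arrangements n m))))) ⟩
      ι n * D - ι m * D
        ≡⟨ cong (λ z → ι n * D - z) (trans (sym (ℚ.*-identityˡ _)) (cong (_* (ι m * D)) (sym (ι*inv n)))) ⟩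
      ι n * D - ι n * v * (ι m * D)
        ≡⟨ solve 4 (λ n d v m → n :* d :- n :* v :* (m :* d) := n :* d :* (con 1ℚ :- m :* v)) refl (ι n) D v (ι m) ⟩
      ι n * D * (1ℚ - ι m * v)
        ≡⟨ cong (λ z → ι n * z * (1ℚ - ι m * v)) (ι-arrangements m) ⟩
      ι n * (ι (n ℕ.^ m) * ρ v m) * (1ℚ - ι m * v)
        ≡⟨ solve 4 (λ n a r s → n :* (a :* r) :* s := n :* a :* (r :* s)) refl (ι n) (ι (n ℕ.^ m)) (ρ v m) (1ℚ - ι m * v) ⟩
      ι n * ι (n ℕ.^ m) * ρ v (suc m)
        ≡⟨ cong (_* ρ v (suc m)) (ι-* n (n ℕ.^ m)) ⟨
      ι (n ℕ.^ suc m) * ρ v (suc m) ∎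
      where
      open ≡-Reasoning
      D = ι (arrangements n m)

    ι-conjugacies : ∀ k m r → (∀ s → Distinct s → Distinct (r s)) →
      ι (conjugacies (suc k) n m r) ≡ ι ((n ℕ.^ n) ℕ.^ suc k) * ρ v m ^ suc k
    ι-conjugacies k m r r-distinct = ι-cancelˡ ((n ℕ.^ m) ℕ.^ suc k) {{ℕ.m^n≢0 (n ℕ.^ m) (suc k) {{ℕ.m^n≢0 n m}}}} (begin
      ι ((n ℕ.^ m) ℕ.^ suc k) * ι (conjugacies (suc k) n m r)
        ≡⟨ ι-* ((n ℕ.^ m) ℕ.^ suc k) _ ⟨
      ι ((n ℕ.^ m) ℕ.^ suc k ℕ.* conjugacies (suc k) n m r)
        ≡⟨ cong ι (∑-conjugacies n k r r-distinct) ⟩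
      ι ((n ℕ.^ n ℕ.* arrangements n m) ℕ.^ suc k)
        ≡⟨ ι-^ (n ℕ.^ n ℕ.* arrangements n m) (suc k) ⟩
      ι (n ℕ.^ n ℕ.* arrangements n m) ^ suc k
        ≡⟨ cong (_^ suc k) (trans (ι-* (n ℕ.^ n) (arrangements n m)) (trans (cong (ι (n ℕ.^ n) *_) (ι-arrangements m))
             (solve 3 (λ a b c → a :* (b :* c) := b :* (a :* c)) refl (ι (n ℕ.^ n)) (ι (n ℕ.^ m)) (ρ v m)))) ⟩
      (ι (n ℕ.^ m) * (ι (n ℕ.^ n) * ρ v m)) ^ suc k
        ≡⟨ trans (^-distrib-* (ι (n ℕ.^ m)) (ι (n ℕ.^ n) * ρ v m) (suc k))
             (cong₂ _*_ (sym (ι-^ (n ℕ.^ m) (suc k)))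
               (trans (^-distrib-* (ι (n ℕ.^ n)) (ρ v m) (suc k)) (cong (_* ρ v m ^ suc k) (sym (ι-^ (n ℕ.^ n) (suc k)))))) ⟩
      ι ((n ℕ.^ m) ℕ.^ suc k) * (ι ((n ℕ.^ n) ℕ.^ suc k) * ρ v m ^ suc k) ∎)
      where open ≡-Reasoning

    probability-formula : ∀ k m → ι (suc m) * probability (suc k) (suc m) n
      ≡ ρ v (suc m) ^ suc k * (1ℚ - (1ℚ - ι (suc m) * v) ^ suc k)
    probability-formula k m = ι-cancelˡ T {{T≢0}} (begin
      ι T * (ι (suc m) * probability (suc k) (suc m) n)
        ≡⟨ cong (λ z → ι T * (ι (suc m) * z)) (trans (/≡ι*inv E (n ℕ.^ (suc k ℕ.* n)) {{ℕ.m^n≢0 n (suc k ℕ.* n)}})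
             (cong (ι E *_) (inv-cong {{ℕ.m^n≢0 n (suc k ℕ.* n)}} {{T≢0}} n^kn≡T))) ⟩
      ι T * (ι (suc m) * (ι E * inv T {{T≢0}}))
        ≡⟨ solve 4 (λ t s e i → t :* (s :* (e :* i)) := t :* i :* (s :* e)) refl (ι T) (ι (suc m)) (ι E) (inv T {{T≢0}}) ⟩
      ι T * inv T {{T≢0}} * (ι (suc m) * ι E)
        ≡⟨ trans (cong (_* (ι (suc m) * ι E)) (ι*inv T {{T≢0}})) (trans (ℚ.*-identityˡ _) (sym (ι-* (suc m) E))) ⟩
      ι (suc m ℕ.* E)
        ≡⟨ solve 2 (λ x y → x := (x :+ y) :- y) refl (ι (suc m ℕ.* E)) (ι Z) ⟩
      (ι (suc m ℕ.* E) + ι Z) - ι Z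
        ≡⟨ cong (_- ι Z) (trans (sym (ι-+ (suc m ℕ.* E) Z)) (cong ι (cyclicTuples-conjugacies k m n))) ⟩
      ι W - ι Z
        -- By definition `ρ` gains one linear factor from `suc m` to `suc (suc m)`; its power is
        -- `Y`.
        ≡⟨ cong₂ _-_ (ι-conjugacies k (suc m) rotate distinct-rotate)
             (trans (ι-conjugacies k (suc (suc m)) rotateTail distinct-rotateTail)
               (cong (ι T *_) (^-distrib-* (ρ v (suc m)) (1ℚ - ι (suc m) * v) (suc k)))) ⟩
      ι T * X - ι T * (X * Y)
        ≡⟨ solve 3 (λ t x y → t :* x :- t :* (x :* y) := t :* (x :* (con 1ℚ :- y))) refl (ι T) X Y ⟩
      ι T * (X * (1ℚ - Y)) ∎)
      where
      open ≡-Reasoning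
      T = (n ℕ.^ n) ℕ.^ suc k
      T≢0 : NonZero T
      T≢0 = ℕ.m^n≢0 (n ℕ.^ n) (suc k) {{ℕ.m^n≢0 n n}}
      E = cyclicTuples (suc k) (suc m) n
      W = conjugacies (suc k) n (suc m) rotate
      Z = conjugacies (suc k) n (suc (suc m)) rotateTail
      X = ρ v (suc m) ^ suc k
      Y = (1ℚ - ι (suc m) * v) ^ suc k
      n^kn≡T : n ℕ.^ (suc k ℕ.* n) ≡ T
      n^kn≡T = trans (cong (n ℕ.^_) (ℕ.*-comm (suc k) n)) (sym (ℕ.^-*-assoc n n (suc k)))
      inv-cong : ∀ {a b} .{{_ : NonZero a}} .{{_ : NonZero b}} → a ≡ b → inv a ≡ inv b
      inv-cong refl = refl

  -- Inequalities and first-order expansions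

  ≤-gap : ∀ {p q} d → 0ℚ ≤ d → p + d ≡ q → p ≤ q
  ≤-gap {p} d 0≤d refl = subst (_≤ p + d) (ℚ.+-identityʳ p) (ℚ.+-monoʳ-≤ p 0≤d)

  0≤q-p : ∀ {p q} → p ≤ q → 0ℚ ≤ q - p
  0≤q-p {p} {q} p≤q = subst (_≤ q - p) (ℚ.+-inverseʳ p) (ℚ.+-monoˡ-≤ (- p) p≤q)

  0≤* : ∀ {p q} → 0ℚ ≤ p → 0ℚ ≤ q → 0ℚ ≤ p * q
  0≤* {p} {q} 0≤p 0≤q = subst (_≤ p * q) (ℚ.*-zeroʳ p) (ℚ.*-monoˡ-≤-nonNeg p {{nonNegative 0≤p}} 0≤q)

  0≤+ : ∀ {p q} → 0ℚ ≤ p → 0ℚ ≤ q → 0ℚ ≤ p + q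
  0≤+ = ℚ.+-mono-≤

  0≤1 : 0ℚ ≤ 1ℚ
  0≤1 = ℚ.nonNegative⁻¹ 1ℚ

  *≤1 : ∀ {p q} → 0ℚ ≤ p → p ≤ 1ℚ → q ≤ 1ℚ → p * q ≤ 1ℚ
  *≤1 {p} {q} 0≤p p≤1 q≤1 = ≤-gap ((1ℚ - p) + p * (1ℚ - q)) (0≤+ (0≤q-p p≤1) (0≤* 0≤p (0≤q-p q≤1)))
    (solve 2 (λ p q → p :* q :+ ((con 1ℚ :- p) :+ p :* (con 1ℚ :- q)) := con 1ℚ) refl p q)

  0≤^ : ∀ {p} → 0ℚ ≤ p → ∀ n → 0ℚ ≤ p ^ n
  0≤^ 0≤p zero    = 0≤1
  0≤^ 0≤p (suc n) = 0≤* 0≤p (0≤^ 0≤p n)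

  ^≤1 : ∀ {p} → 0ℚ ≤ p → p ≤ 1ℚ → ∀ n → p ^ n ≤ 1ℚ
  ^≤1 0≤p p≤1 zero    = ℚ.≤-refl
  ^≤1 0≤p p≤1 (suc n) = *≤1 0≤p p≤1 (^≤1 0≤p p≤1 n)

  -- The slope of the `n`-th power on [0,1] is at most `n`. The two bounds share an induction
  -- because the upper one uses the lower one.
  ^-gap : ∀ {r q} → 0ℚ ≤ r → r ≤ q → q ≤ 1ℚ → ∀ n → r ^ n ≤ q ^ n × q ^ n ≤ r ^ n + ι n * (q - r)
  ^-gap {r} {q} 0≤r r≤q q≤1 zero = ℚ.≤-refl , ℚ.≤-reflexive
    (solve 2 (λ r q → con 1ℚ := con 1ℚ :+ con 0ℚ :* (q :- r)) refl r q)
  ^-gap {r} {q} 0≤r r≤q q≤1 (suc n) with ^-gap 0≤r r≤q q≤1 n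
  ... | lower , upper =
    -- The gap is displayed as a sum of products of nonnegative quantities, which leaves a
    -- polynomial identity; `expansion-*` proceeds alike.
    ≤-gap (q * (q ^ n - r ^ n) + (q - r) * r ^ n)
      (0≤+ (0≤* 0≤q (0≤q-p lower)) (0≤* (0≤q-p r≤q) (0≤^ 0≤r n)))
      (solve 4 (λ q r a b → r :* b :+ (q :* (a :- b) :+ (q :- r) :* b) := q :* a) refl q r (q ^ n) (r ^ n)) ,
    ≤-gap ((1ℚ - q) * (q ^ n - r ^ n) + (q - r) * (1ℚ - r ^ n) + (r ^ n + ι n * (q - r) - q ^ n))
      (0≤+ (0≤+ (0≤* (0≤q-p q≤1) (0≤q-p lower)) (0≤* (0≤q-p r≤q) (0≤q-p (^≤1 0≤r (ℚ.≤-trans r≤q q≤1) n)))) (0≤q-p upper))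
      (trans (solve 5 (λ q r a b i →
          q :* a :+ ((con 1ℚ :- q) :* (a :- b) :+ (q :- r) :* (con 1ℚ :- b) :+ (b :+ i :* (q :- r) :- a))
          := r :* b :+ (con 1ℚ :+ i) :* (q :- r)) refl q r (q ^ n) (r ^ n) (ι n))
        (cong (λ z → r ^ suc n + z * (q - r)) (sym (ι-suc n))))
    where
    0≤q : 0ℚ ≤ q
    0≤q = ℚ.≤-trans 0≤r r≤q

  -- With v = 1 / n this is q = 1 - a/n + O(1/n²), provided that a and K do not depend on n.
  record Expansion (v : ℚ) (a K : ℕ) (q : ℚ) : Set where
    field
      nonNeg : 0ℚ ≤ q
      ≤1     : q ≤ 1ℚ
      lower  : 1ℚ - ι a * v ≤ q
      upper  : q ≤ 1ℚ - ι a * v + ι K * (v * v)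

  expansion-1 : ∀ v → Expansion v 0 0 1ℚ
  expansion-1 v = record
    { nonNeg = 0≤1
    ; ≤1     = ℚ.≤-refl
    ; lower  = ℚ.≤-reflexive (solve 1 (λ v → con 1ℚ :- con 0ℚ :* v := con 1ℚ) refl v)
    ; upper  = ℚ.≤-reflexive (solve 1 (λ v → con 1ℚ := con 1ℚ :- con 0ℚ :* v :+ con 0ℚ :* (v :* v)) refl v)
    }

  -- Both bounds rest on `p q = p + q - 1 + (1 - p)(1 - q)`: the last product lies between 0 and
  -- `(a v)(b v)`, whence the extra `a * b` in the constant.
  expansion-* : ∀ {v a b K L p q} → 0ℚ ≤ v → Expansion v a K p → Expansion v b L q →
    Expansion v (a ℕ.+ b) (K ℕ.+ L ℕ.+ a ℕ.* b) (p * q)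
  expansion-* {v} {a} {b} {K} {L} {p} {q} 0≤v E F = record
    { nonNeg = 0≤* E.nonNeg F.nonNeg
    ; ≤1     = *≤1 E.nonNeg E.≤1 F.≤1
    ; lower  = ≤-gap ((p - (1ℚ - ι a * v)) + (q - (1ℚ - ι b * v)) + (1ℚ - p) * (1ℚ - q))
        (0≤+ (0≤+ (0≤q-p E.lower) (0≤q-p F.lower)) (0≤* (0≤q-p E.≤1) (0≤q-p F.≤1)))
        (trans
          (cong (λ z → 1ℚ - z * v + ((p - (1ℚ - ι a * v)) + (q - (1ℚ - ι b * v)) + (1ℚ - p) * (1ℚ - q))) (ι-+ a b))
          (solve 5 (λ p q a b v → con 1ℚ :- (a :+ b) :* v :+
            ((p :- (con 1ℚ :- a :* v)) :+ (q :- (con 1ℚ :- b :* v)) :+ (con 1ℚ :- p) :* (con 1ℚ :- q)) := p :* q)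
            refl p q (ι a) (ι b) v))
    ; upper  = ≤-gap (((1ℚ - ι a * v + ι K * (v * v)) - p) + ((1ℚ - ι b * v + ι L * (v * v)) - q)
          + ((p - (1ℚ - ι a * v)) * (ι b * v) + (1ℚ - p) * (q - (1ℚ - ι b * v))))
        (0≤+ (0≤+ (0≤q-p E.upper) (0≤q-p F.upper))
          (0≤+ (0≤* (0≤q-p E.lower) (0≤* (0≤ι b) 0≤v)) (0≤* (0≤q-p E.≤1) (0≤q-p F.lower))))
        (trans (solve 7 (λ p q a b v k l → p :* q :+
            (((con 1ℚ :- a :* v :+ k :* (v :* v)) :- p) :+ ((con 1ℚ :- b :* v :+ l :* (v :* v)) :- q)
            :+ ((p :- (con 1ℚ :- a :* v)) :* (b :* v) :+ (con 1ℚ :- p) :* (q :- (con 1ℚ :- b :* v))))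
            := con 1ℚ :- (a :+ b) :* v :+ (k :+ l :+ a :* b) :* (v :* v)) refl p q (ι a) (ι b) v (ι K) (ι L))
          (cong₂ (λ x y → 1ℚ - x * v + y * (v * v)) (sym (ι-+ a b))
            (sym (trans (ι-+ (K ℕ.+ L) (a ℕ.* b)) (cong₂ _+_ (ι-+ K L) (ι-* a b))))))
    }
    where
    module E = Expansion E
    module F = Expansion F

  expansion-^ : ∀ a K c → ∃[ L ] ∀ {v q} → 0ℚ ≤ v → Expansion v a K q → Expansion v (c ℕ.* a) L (q ^ c)
  expansion-^ a K zero    = 0 , λ {v} _ _ → expansion-1 v
  expansion-^ a K (suc c) with L , H ← expansion-^ a K c = _ , λ 0≤v E → expansion-* 0≤v E (H 0≤v E)

  0≤inv : ∀ n .{{_ : NonZero n}} → 0ℚ ≤ inv n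
  0≤inv (suc d) = /-≤ (+ 0) (+ 1) 0 d (ℤ.+≤+ z≤n)

  ι*inv≤1 : ∀ {j n} .{{_ : NonZero n}} → j ℕ.≤ n → ι j * inv n ≤ 1ℚ
  ι*inv≤1 {j} {n} j≤n = subst (ι j * inv n ≤_) (ι*inv n) (ℚ.*-monoʳ-≤-nonNeg (inv n) {{nonNegative (0≤inv n)}} (ι-mono j≤n))

  expansion-linear : ∀ {j n} .{{_ : NonZero n}} → j ℕ.≤ n → Expansion (inv n) j 0 (1ℚ - ι j * inv n)
  expansion-linear {j} {n} j≤n = record
    { nonNeg = 0≤q-p (ι*inv≤1 j≤n)
    ; ≤1     = ≤-gap (ι j * v) (0≤* (0≤ι j) (0≤inv n)) (solve 1 (λ x → con 1ℚ :- x :+ x := con 1ℚ) refl (ι j * v))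
    ; lower  = ℚ.≤-refl
    ; upper  = ℚ.≤-reflexive (solve 2 (λ j v → con 1ℚ :- j :* v := con 1ℚ :- j :* v :+ con 0ℚ :* (v :* v)) refl (ι j) v)
    }
    where v = inv n

  C2-suc : ∀ n → (n C 2) ℕ.+ n ≡ suc n C 2
  C2-suc n = trans (ℕ.+-comm (n C 2) n) (trans (cong (ℕ._+ n C 2) (sym (nC1≡n n))) (nCk+nC[k+1]≡[n+1]C[k+1] n 1))

  -- The linear coefficient is the sum of all `i < m`. `K` stands before `n`, since the error must
  -- be uniform in `n`.
  expansion-ρ : ∀ m → ∃[ K ] ∀ n .{{_ : NonZero n}} → m ℕ.≤ n → Expansion (inv n) (m C 2) K (ρ (inv n) m)
  expansion-ρ zero    = 0 , λ n _ → expansion-1 (inv n)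
  expansion-ρ (suc m) with K , H ← expansion-ρ m =
    L , λ n m<n → subst (λ a → Expansion (inv n) a L (ρ (inv n) (suc m))) (C2-suc m)
    (expansion-* (0≤inv n) (H n (ℕ.<⇒≤ m<n)) (expansion-linear (ℕ.<⇒≤ m<n)))
    where L = K ℕ.+ 0 ℕ.+ (m C 2) ℕ.* m

  -- Binomial expansion against the exponential series

  sumBelow-cong : ∀ {f g} → (∀ i → f i ≡ g i) → ∀ m → sumBelow f m ≡ sumBelow g m
  sumBelow-cong e zero    = refl
  sumBelow-cong e (suc m) = cong₂ _+_ (sumBelow-cong e m) (e m)

  1/! : ℕ → ℚ
  1/! i = inv (i !) {{i ℕ.!≢0}}

  1/!-suc : ∀ i → 1/! i ≡ (1ℚ + ι i) * 1/! (suc i)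
  1/!-suc i = sym (begin
    (1ℚ + ι i) * 1/! (suc i)            ≡⟨ cong₂ _*_ (sym (ι-suc i)) (1/-* (suc i) (i !) {{_}} {{i ℕ.!≢0}}) ⟩
    ι (suc i) * (inv (suc i) * 1/! i)   ≡⟨ ℚ.*-assoc (ι (suc i)) (inv (suc i)) (1/! i) ⟨
    ι (suc i) * inv (suc i) * 1/! i     ≡⟨ cong (_* 1/! i) (ι*inv (suc i)) ⟩
    1ℚ * 1/! i                          ≡⟨ ℚ.*-identityˡ (1/! i) ⟩
    1/! i                               ∎)
    where open ≡-Reasoning

  fall : ℚ → ℕ → ℚ
  fall x zero    = 1ℚ
  fall x (suc i) = fall x i * (x - ι i)

  fall-1+ : ∀ x i → fall (1ℚ + x) (suc i) ≡ (1ℚ + x) * fall x i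
  fall-1+ x zero    = solve 1 (λ x → con 1ℚ :* (con 1ℚ :+ x :- con 0ℚ) := (con 1ℚ :+ x) :* con 1ℚ) refl x
  fall-1+ x (suc i) = trans (cong₂ (λ a b → a * (1ℚ + x - b)) (fall-1+ x i) (ι-suc i))
    (solve 3 (λ x f i → (con 1ℚ :+ x) :* f :* (con 1ℚ :+ x :- (con 1ℚ :+ i)) := (con 1ℚ :+ x) :* (f :* (x :- i))) refl x (fall x i) (ι i))

  -- The binomial coefficient is written as a falling factorial over a factorial, so that the factor
  -- `1/! i` of `expTerm` is visible and the terms with `i > n` vanish.
  binomialTerm : ℕ → ℚ → ℕ → ℚ
  binomialTerm n y i = fall (ι n) i * 1/! i * y ^ i

  binomialTerm-pascal : ∀ n y i → binomialTerm (suc n) y (suc i) ≡ binomialTerm n y (suc i) + y * binomialTerm n y i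
  binomialTerm-pascal n y i = trans
    (cong (λ z → z * r * (y * y ^ i)) (trans (cong (λ x → fall x (suc i)) (ι-suc n)) (fall-1+ (ι n) i)))
    (trans (solve 6 (λ n i f r y p → (con 1ℚ :+ n) :* f :* r :* (y :* p)
        := f :* (n :- i) :* r :* (y :* p) :+ y :* (f :* ((con 1ℚ :+ i) :* r) :* p)) refl (ι n) (ι i) (fall (ι n) i) r y (y ^ i))
      (cong (λ z → binomialTerm n y (suc i) + y * (fall (ι n) i * z * y ^ i)) (sym (1/!-suc i))))
    where r = 1/! (suc i)

  sum-binomialTerm-suc : ∀ n y m → sumBelow (binomialTerm (suc n) y) (suc m)
    ≡ sumBelow (binomialTerm n y) (suc m) + y * sumBelow (binomialTerm n y) m
  sum-binomialTerm-suc n y zero    = sym (trans (cong (λ z → 1ℚ + z) (ℚ.*-zeroʳ y)) (ℚ.+-identityʳ 1ℚ))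
  sum-binomialTerm-suc n y (suc m) = trans
    (cong₂ _+_ (sum-binomialTerm-suc n y m) (binomialTerm-pascal n y m))
    (solve 5 (λ s t u y w → (s :+ y :* t) :+ (u :+ y :* w) := (s :+ u) :+ y :* (t :+ w)) refl
      (sumBelow (binomialTerm n y) (suc m)) (sumBelow (binomialTerm n y) m)
      (binomialTerm n y (suc m)) y (binomialTerm n y m))

  -- The vanishing terms allow any length `m > n`; this makes one power comparable with all late
  -- partial sums of `exp`.
  binomial : ∀ n y m → n ℕ.< m → sumBelow (binomialTerm n y) m ≡ (1ℚ + y) ^ n
  binomial zero y (suc m) _ = vanish m
    where
    fall-0 : ∀ i → fall 0ℚ (suc i) ≡ 0ℚ
    fall-0 zero    = refl
    fall-0 (suc i) = trans (cong (_* (0ℚ - ι (suc i))) (fall-0 i)) (ℚ.*-zeroˡ (0ℚ - ι (suc i)))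
    vanish : ∀ m → sumBelow (binomialTerm 0 y) (suc m) ≡ 1ℚ
    vanish zero    = refl
    vanish (suc m) = trans (cong₂ _+_ (vanish m) (trans (cong (λ z → z * 1/! (suc m) * y ^ suc m) (fall-0 m))
      (solve 2 (λ a b → con 0ℚ :* a :* b := con 0ℚ) refl (1/! (suc m)) (y ^ suc m)))) (ℚ.+-identityʳ 1ℚ)
  binomial (suc n) y (suc m) (s≤s n<m) = trans (sum-binomialTerm-suc n y m)
    (trans (cong₂ (λ a b → a + y * b) (binomial n y (suc m) (ℕ.m≤n⇒m≤1+n n<m)) (binomial n y m n<m))
      (solve 2 (λ p y → p :+ y :* p := (con 1ℚ :+ y) :* p) refl ((1ℚ + y) ^ n) y))

  2^ : ℕ → ℚ
  2^ i = ι 2 ^ i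

  module _ (n : ℕ) .{{_ : NonZero n}} where
    private v = inv n

    -- The falling factorial of `n` times `i` factors `v` is `ρ v i`: the expansion is the
    -- exponential series with damped terms.
    binomialTerm-ρ : ∀ q i → binomialTerm n (q * v) i ≡ expTerm q i * ρ v i
    binomialTerm-ρ q i = trans (solve 3 (λ f r p → f :* r :* p := f :* p :* r) refl (fall (ι n) i) (1/! i) ((q * v) ^ i))
      (trans (cong (_* 1/! i) (scale i))
        (solve 3 (λ a b c → a :* b :* c := a :* c :* b) refl (q ^ i) (ρ v i) (1/! i)))
      where
      open ≡-Reasoning
      scale : ∀ i → fall (ι n) i * (q * v) ^ i ≡ q ^ i * ρ v i
      scale zero    = refl
      scale (suc i) = begin
        fall (ι n) i * (ι n - ι i) * (q * v * (q * v) ^ i)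
          ≡⟨ solve 6 (λ f n i q v p → f :* (n :- i) :* (q :* v :* p) := f :* p :* q :* (n :* v :- i :* v)) refl
               (fall (ι n) i) (ι n) (ι i) q v ((q * v) ^ i) ⟩
        fall (ι n) i * (q * v) ^ i * q * (ι n * v - ι i * v)
          ≡⟨ cong₂ (λ x y → x * q * (y - ι i * v)) (scale i) (ι*inv n) ⟩
        q ^ i * ρ v i * q * (1ℚ - ι i * v)
          ≡⟨ solve 4 (λ p r q w → p :* r :* q :* w := q :* p :* (r :* w)) refl (q ^ i) (ρ v i) q (1ℚ - ι i * v) ⟩
        q ^ suc i * ρ v (suc i) ∎

    ρ-vanishes : ∀ i → n ℕ.< i → ρ v i ≡ 0ℚ
    ρ-vanishes (suc i) (s≤s n≤i) with i ℕ.≟ n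
    ... | yes refl = trans (cong (λ z → ρ v n * (1ℚ - z)) (ι*inv n)) (ℚ.*-zeroʳ (ρ v n))
    ... | no  i≢n  = trans (cong (_* (1ℚ - ι i * v)) (ρ-vanishes i (ℕ.≤∧≢⇒< n≤i λ e → i≢n (sym e))))
      (ℚ.*-zeroˡ (1ℚ - ι i * v))

    -- Beyond `n` the new factors may be negative, so there the bounds come from `ρ` being zero.
    0≤ρ≤1 : ∀ i → 0ℚ ≤ ρ v i × ρ v i ≤ 1ℚ
    0≤ρ≤1 i with i ℕ.≤? n
    ... | yes i≤n with E ← proj₂ (expansion-ρ i) n i≤n = Expansion.nonNeg E , Expansion.≤1 E
    ... | no  i≰n = subst (λ z → 0ℚ ≤ z × z ≤ 1ℚ) (sym (ρ-vanishes i (ℕ.≰⇒> i≰n))) (ℚ.≤-refl , 0≤1)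

    -- The sharp constant is i(i-1)/2; with 2ⁱ the errors add up to an exponential series again.
    1-ρ≤ : ∀ i → 1ℚ - ρ v i ≤ v * 2^ i
    1-ρ≤ zero    = 0≤* (0≤inv n) 0≤1
    1-ρ≤ (suc i) = ≤-gap ((v * 2^ i - (1ℚ - ρ v i)) + (1ℚ - ρ v i) * (ι i * v) + v * (2^ i - ι i))
      (0≤+ (0≤+ (0≤q-p (1-ρ≤ i)) (0≤* (0≤q-p (proj₂ (0≤ρ≤1 i))) (0≤* (0≤ι i) (0≤inv n)))) (0≤* (0≤inv n) (0≤q-p (ι≤2^ i))))
      (solve 4 (λ r i v t → con 1ℚ :- r :* (con 1ℚ :- i :* v)
        :+ ((v :* t :- (con 1ℚ :- r)) :+ (con 1ℚ :- r) :* (i :* v) :+ v :* (t :- i))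
        := v :* (con (ι 2) :* t)) refl (ρ v i) (ι i) v (2^ i))
      where
      1≤2^ : ∀ i → 1ℚ ≤ 2^ i
      1≤2^ zero    = ℚ.≤-refl
      1≤2^ (suc i) = ≤-gap (2^ i + (2^ i - 1ℚ)) (0≤+ (ℚ.≤-trans 0≤1 (1≤2^ i)) (0≤q-p (1≤2^ i)))
        (solve 1 (λ t → con 1ℚ :+ (t :+ (t :- con 1ℚ)) := con (ι 2) :* t) refl (2^ i))
      ι≤2^ : ∀ i → ι i ≤ 2^ i
      ι≤2^ zero    = 0≤1
      ι≤2^ (suc i) = subst (_≤ 2^ (suc i)) (sym (ι-suc i)) (≤-gap ((2^ i - 1ℚ) + (2^ i - ι i)) (0≤+ (0≤q-p (1≤2^ i)) (0≤q-p (ι≤2^ i)))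
        (solve 2 (λ t i → con 1ℚ :+ i :+ ((t :- con 1ℚ) :+ (t :- i)) := con (ι 2) :* t) refl (2^ i) (ι i)))

    expTerm-error : ∀ q i → ∣ expTerm q i * ρ v i - expTerm q i ∣ ≤ v * expTerm (ι 2 * ∣ q ∣) i
    expTerm-error q i = begin
      ∣ expTerm q i * ρ v i - expTerm q i ∣
        ≡⟨ cong ∣_∣ (solve 2 (λ e r → e :* r :- e := :- (e :* (con 1ℚ :- r))) refl (expTerm q i) (ρ v i)) ⟩
      ∣ - (expTerm q i * (1ℚ - ρ v i)) ∣
        ≡⟨ ℚ.∣-p∣≡∣p∣ (expTerm q i * (1ℚ - ρ v i)) ⟩
      ∣ expTerm q i * (1ℚ - ρ v i) ∣
        ≡⟨ trans (ℚ.∣p*q∣≡∣p∣*∣q∣ (expTerm q i) (1ℚ - ρ v i))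
             (cong (∣ expTerm q i ∣ *_) (ℚ.0≤p⇒∣p∣≡p (0≤q-p (proj₂ (0≤ρ≤1 i))))) ⟩
      ∣ expTerm q i ∣ * (1ℚ - ρ v i)
        ≤⟨ ℚ.*-monoˡ-≤-nonNeg ∣ expTerm q i ∣ {{ℚ.∣-∣-nonNeg (expTerm q i)}} (1-ρ≤ i) ⟩
      ∣ expTerm q i ∣ * (v * 2^ i)
        ≡⟨ cong (_* (v * 2^ i)) (trans (ℚ.∣p*q∣≡∣p∣*∣q∣ (q ^ i) (1/! i))
             (cong₂ _*_ (∣^∣ i) (ℚ.0≤p⇒∣p∣≡p (0≤inv (i !) {{i ℕ.!≢0}})))) ⟩
      ∣ q ∣ ^ i * 1/! i * (v * 2^ i)
        ≡⟨ solve 4 (λ a b c d → a :* b :* (c :* d) := c :* (d :* a :* b)) refl (∣ q ∣ ^ i) (1/! i) v (2^ i) ⟩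
      v * (2^ i * ∣ q ∣ ^ i * 1/! i)
        ≡⟨ cong (λ z → v * (z * 1/! i)) (^-distrib-* (ι 2) ∣ q ∣ i) ⟨
      v * expTerm (ι 2 * ∣ q ∣) i ∎
      where
      open ℚ.≤-Reasoning
      ∣^∣ : ∀ i → ∣ q ^ i ∣ ≡ ∣ q ∣ ^ i
      ∣^∣ zero    = refl
      ∣^∣ (suc i) = trans (ℚ.∣p*q∣≡∣p∣*∣q∣ q (q ^ i)) (cong (∣ q ∣ *_) (∣^∣ i))

    -- The termwise errors sum to `v` times a partial sum for exp(2|q|), which stays bounded as `m`
    -- grows.
    compound-error : ∀ q m → n ℕ.< m →
      ∣ (1ℚ + q * v) ^ n - sumBelow (expTerm q) m ∣ ≤ v * sumBelow (expTerm (ι 2 * ∣ q ∣)) m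
    compound-error q m n<m = subst (λ z → ∣ z - sumBelow (expTerm q) m ∣ ≤ v * sumBelow (expTerm (ι 2 * ∣ q ∣)) m)
      (trans (sumBelow-cong (λ i → sym (binomialTerm-ρ q i)) m) (binomial n (q * v) m n<m)) (go m)
      where
      open ℚ.≤-Reasoning
      go : ∀ m → ∣ sumBelow (λ i → expTerm q i * ρ v i) m - sumBelow (expTerm q) m ∣ ≤ v * sumBelow (expTerm (ι 2 * ∣ q ∣)) m
      go zero    = ℚ.≤-reflexive (sym (ℚ.*-zeroʳ v))
      go (suc m) = begin
        ∣ (S + s) - (T + t) ∣
          ≡⟨ cong ∣_∣ (solve 4 (λ a b c d → (a :+ b) :- (c :+ d) := (a :- c) :+ (b :- d)) refl S s T t) ⟩
        ∣ (S - T) + (s - t) ∣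
          ≤⟨ ℚ.∣p+q∣≤∣p∣+∣q∣ (S - T) (s - t) ⟩
        ∣ S - T ∣ + ∣ s - t ∣
          ≤⟨ ℚ.+-mono-≤ (go m) (expTerm-error q m) ⟩
        v * U + v * expTerm (ι 2 * ∣ q ∣) m
          ≡⟨ ℚ.*-distribˡ-+ v U (expTerm (ι 2 * ∣ q ∣) m) ⟨
        v * (U + expTerm (ι 2 * ∣ q ∣) m) ∎
        where
        S = sumBelow (λ i → expTerm q i * ρ v i) m
        s = expTerm q m * ρ v m
        T = sumBelow (expTerm q) m
        t = expTerm q m
        U = sumBelow (expTerm (ι 2 * ∣ q ∣)) m

  -- Approximation at rate 1/n

  Sequence : Set
  Sequence = (n : ℕ) .{{_ : NonZero n}} → ℚ

  -- The condition n < m ensures that the m-th partial sum covers the whole binomial expansion of an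
  -- n-th power.
  Approximates : Sequence → (ℕ → ℚ) → Set
  Approximates x e = ∃[ B ] 0ℚ ≤ B × ∃[ L ] ∀ n .{{_ : NonZero n}} → L ℕ.≤ n → ∀ m → n ℕ.< m →
    ∣ x n - e m ∣ ≤ B * inv n

  p≤∣p∣ : ∀ p → p ≤ ∣ p ∣
  p≤∣p∣ p with ℚ.≤-total 0ℚ p
  ... | inj₁ 0≤p = ℚ.≤-reflexive (sym (ℚ.0≤p⇒∣p∣≡p 0≤p))
  ... | inj₂ p≤0 = ℚ.≤-trans p≤0 (ℚ.0≤∣p∣ p)

  -- The bases differ by at most K/n², and the `n`-th power multiplies this by at most `n`. The
  -- condition `a ≤ n` keeps the smaller base nonnegative.
  expansion-error : ∀ a K n .{{_ : NonZero n}} → a ℕ.≤ n → ∀ q → Expansion (inv n) a K q →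
    ∣ q ^ n - (1ℚ + - ι a * inv n) ^ n ∣ ≤ ι K * inv n
  expansion-error a K n a≤n q E = begin
    ∣ q ^ n - r ^ n ∣        ≡⟨ ℚ.0≤p⇒∣p∣≡p (0≤q-p (proj₁ gap)) ⟩
    q ^ n - r ^ n            ≤⟨ ℚ.+-monoˡ-≤ (- (r ^ n)) (proj₂ gap) ⟩
    r ^ n + ι n * (q - r) - r ^ n
      ≡⟨ solve 2 (λ x y → x :+ y :- x := y) refl (r ^ n) (ι n * (q - r)) ⟩
    ι n * (q - r)
      ≤⟨ ℚ.*-monoˡ-≤-nonNeg (ι n) {{nonNegative (0≤ι n)}}
           (≤-gap (1ℚ - ι a * v + ι K * (v * v) - q) (0≤q-p E.upper)
             (solve 5 (λ q a v k w → (q :- (con 1ℚ :+ (:- a) :* v)) :+ (con 1ℚ :- a :* v :+ k :* w :- q) := k :* w)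
               refl q (ι a) v (ι K) (v * v))) ⟩
    ι n * (ι K * (v * v))    ≡⟨ solve 3 (λ n k v → n :* (k :* (v :* v)) := k :* (n :* v) :* v) refl (ι n) (ι K) v ⟩
    ι K * (ι n * v) * v      ≡⟨ cong (λ z → ι K * z * v) (ι*inv n) ⟩
    ι K * 1ℚ * v             ≡⟨ cong (_* v) (ℚ.*-identityʳ (ι K)) ⟩
    ι K * v                  ∎
    where
    open ℚ.≤-Reasoning
    v = inv n
    r = 1ℚ + - ι a * v
    module E = Expansion E
    r≡ : 1ℚ - ι a * v ≡ r
    r≡ = solve 2 (λ a v → con 1ℚ :- a :* v := con 1ℚ :+ (:- a) :* v) refl (ι a) v
    gap : r ^ n ≤ q ^ n × q ^ n ≤ r ^ n + ι n * (q - r)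
    gap = ^-gap (subst (0ℚ ≤_) r≡ (0≤q-p (ι*inv≤1 a≤n))) (subst (_≤ q) r≡ E.lower) E.≤1 n

  approximates-exp : ∀ {a K N} {q : Sequence} → (∀ n .{{_ : NonZero n}} → N ℕ.≤ n → Expansion (inv n) a K (q n)) →
    Approximates (λ n → q n ^ n) (sumBelow (expTerm (- ι a)))
  approximates-exp {a} {K} {N} {q} expansion =
    let B , 0<B , L , bounded = eventuallyBounded {sumBelow (expTerm (ι 2 * ∣ - ι a ∣))} (cauchy (exp (ι 2 * ∣ - ι a ∣))) in
    -- `ι K` pays for replacing `q n` by its linear part, `B` for the series; `L` is passed because
    -- `m > n ≥ L` puts `m` where `B` is a bound.
    ι K + B , 0≤+ (0≤ι K) (ℚ.<⇒≤ 0<B) , a ℕ.⊔ (N ℕ.⊔ L) , λ n L′≤n m n<m →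
      estimate n (ℕ.m⊔n≤o⇒m≤o a _ L′≤n) (ℕ.m⊔n≤o⇒m≤o N L (ℕ.m⊔n≤o⇒n≤o a _ L′≤n)) m n<m
        (bounded m (ℕ.≤-trans (ℕ.m⊔n≤o⇒n≤o N L (ℕ.m⊔n≤o⇒n≤o a _ L′≤n)) (ℕ.<⇒≤ n<m)))
    where
    open ℚ.≤-Reasoning
    estimate : ∀ n .{{_ : NonZero n}} → a ℕ.≤ n → N ℕ.≤ n → ∀ m → n ℕ.< m → ∀ {B} →
      ∣ sumBelow (expTerm (ι 2 * ∣ - ι a ∣)) m ∣ ≤ B → ∣ q n ^ n - sumBelow (expTerm (- ι a)) m ∣ ≤ (ι K + B) * inv n
    estimate n a≤n N≤n m n<m {B} S≤B = begin
      ∣ x - e ∣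
        ≡⟨ cong ∣_∣ (solve 3 (λ x y z → x :- z := (x :- y) :+ (y :- z)) refl x y e) ⟩
      ∣ (x - y) + (y - e) ∣
        ≤⟨ ℚ.∣p+q∣≤∣p∣+∣q∣ (x - y) (y - e) ⟩
      ∣ x - y ∣ + ∣ y - e ∣
        ≤⟨ ℚ.+-mono-≤ (expansion-error a K n a≤n (q n) (expansion n N≤n)) (compound-error n (- ι a) m n<m) ⟩
      ι K * v + v * S
        ≤⟨ ℚ.+-monoʳ-≤ (ι K * v) (ℚ.*-monoˡ-≤-nonNeg v {{nonNegative (0≤inv n)}} (ℚ.≤-trans (p≤∣p∣ S) S≤B)) ⟩
      ι K * v + v * B
        ≡⟨ solve 3 (λ k v b → k :* v :+ v :* b := (k :+ b) :* v) refl (ι K) v B ⟩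
      (ι K + B) * v ∎
      where
      v = inv n
      x = q n ^ n
      y = (1ℚ + - ι a * v) ^ n
      e = sumBelow (expTerm (- ι a)) m
      S = sumBelow (expTerm (ι 2 * ∣ - ι a ∣)) m

  -- The error of a product needs one bounded factor from each side: `e m` for late `m`, as `e` is
  -- Cauchy, and `1 - y n`, as `y n` lies in [0,1].
  approximates-product : ∀ {x y : Sequence} {e f N} → Cauchy e → Approximates x e → Approximates y f →
    (∀ n .{{_ : NonZero n}} → N ℕ.≤ n → 0ℚ ≤ y n × y n ≤ 1ℚ) →
    Approximates (λ n → x n * (1ℚ - y n)) (λ m → e m * (1ℚ - f m))
  approximates-product {x} {y} {e} {f} {N} cauchy-e (B , 0≤B , L , x-e) (B′ , 0≤B′ , M , y-f) 0≤y≤1 =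
    let A , 0<A , K , bounded = eventuallyBounded {e} cauchy-e in
    (B + B′) * (A + 1ℚ) , 0≤* (0≤+ 0≤B 0≤B′) (0≤+ (ℚ.<⇒≤ 0<A) 0≤1) , (L ℕ.⊔ M) ℕ.⊔ (N ℕ.⊔ K) , λ n large m n<m →
      let LM≤n = ℕ.m⊔n≤o⇒m≤o (L ℕ.⊔ M) _ large
          NK≤n = ℕ.m⊔n≤o⇒n≤o (L ℕ.⊔ M) _ large
      in estimate n m (ℚ.<⇒≤ 0<A)
        (bounded m (ℕ.≤-trans (ℕ.m⊔n≤o⇒n≤o N K NK≤n) (ℕ.<⇒≤ n<m))) (0≤y≤1 n (ℕ.m⊔n≤o⇒m≤o N K NK≤n))
        (x-e n (ℕ.m⊔n≤o⇒m≤o L M LM≤n) m n<m) (y-f n (ℕ.m⊔n≤o⇒n≤o L M LM≤n) m n<m)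
    where
    open ℚ.≤-Reasoning
    estimate : ∀ n .{{_ : NonZero n}} m {A} → 0ℚ ≤ A → ∣ e m ∣ ≤ A → 0ℚ ≤ y n × y n ≤ 1ℚ →
      ∣ x n - e m ∣ ≤ B * inv n → ∣ y n - f m ∣ ≤ B′ * inv n →
      ∣ x n * (1ℚ - y n) - e m * (1ℚ - f m) ∣ ≤ (B + B′) * (A + 1ℚ) * inv n
    estimate n m {A} 0≤A ∣e∣≤A (0≤y , y≤1) x-e≤ y-f≤ = begin
      ∣ X * (1ℚ - Y) - E * (1ℚ - F) ∣
        ≤⟨ ∣*-difference∣≤ {x = X} {1ℚ - Y} {E} {1ℚ - F} 0≤A (0≤* (0≤+ 0≤B 0≤B′) 0≤v) ∣e∣≤A ∣1-Y∣≤1 X-E≤ Y-F≤ ⟩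
      (B + B′) * v * (A + 1ℚ)
        ≡⟨ solve 3 (λ b v a → b :* v :* a := b :* a :* v) refl (B + B′) v (A + 1ℚ) ⟩
      (B + B′) * (A + 1ℚ) * v ∎
      where
      v = inv n
      0≤v = 0≤inv n
      X = x n
      Y = y n
      E = e m
      F = f m
      X-E≤ : ∣ X - E ∣ ≤ (B + B′) * v
      X-E≤ = ℚ.≤-trans x-e≤ (≤-gap (B′ * v) (0≤* 0≤B′ 0≤v) (sym (ℚ.*-distribʳ-+ v B B′)))
      Y-F≤ : ∣ (1ℚ - Y) - (1ℚ - F) ∣ ≤ (B + B′) * v
      Y-F≤ = begin
        ∣ (1ℚ - Y) - (1ℚ - F) ∣  ≡⟨ cong ∣_∣ (solve 2 (λ y f → (con 1ℚ :- y) :- (con 1ℚ :- f) := f :- y) refl Y F) ⟩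
        ∣ F - Y ∣                ≡⟨ ∣-∣-comm F Y ⟩
        ∣ Y - F ∣                ≤⟨ y-f≤ ⟩
        B′ * v                    ≤⟨ ≤-gap (B * v) (0≤* 0≤B 0≤v) (solve 3 (λ b c v → c :* v :+ b :* v := (b :+ c) :* v) refl B B′ v) ⟩
        (B + B′) * v              ∎
      ∣1-Y∣≤1 : ∣ 1ℚ - Y ∣ ≤ 1ℚ
      ∣1-Y∣≤1 = subst (_≤ 1ℚ) (sym (ℚ.0≤p⇒∣p∣≡p (0≤q-p y≤1)))
        (≤-gap Y 0≤y (solve 1 (λ y → con 1ℚ :- y :+ y := con 1ℚ) refl Y))

  approximates-scale : ∀ {x : Sequence} {e s} → 0ℚ ≤ s → s ≤ 1ℚ → Approximates x e →
    Approximates (λ n → s * x n) (λ m → s * e m)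
  approximates-scale {x} {e} {s} 0≤s s≤1 (B , 0≤B , L , x-e) = B , 0≤B , L , λ n L≤n m n<m → begin
    ∣ s * x n - s * e m ∣    ≡⟨ cong ∣_∣ (solve 3 (λ s x e → s :* x :- s :* e := s :* (x :- e)) refl s (x n) (e m)) ⟩
    ∣ s * (x n - e m) ∣      ≡⟨ ℚ.∣p*q∣≡∣p∣*∣q∣ s (x n - e m) ⟩
    ∣ s ∣ * ∣ x n - e m ∣    ≡⟨ cong (_* ∣ x n - e m ∣) (ℚ.0≤p⇒∣p∣≡p 0≤s) ⟩
    s * ∣ x n - e m ∣        ≤⟨ ℚ.*-monoʳ-≤-nonNeg ∣ x n - e m ∣ {{ℚ.∣-∣-nonNeg (x n - e m)}} s≤1 ⟩
    1ℚ * ∣ x n - e m ∣       ≡⟨ ℚ.*-identityˡ ∣ x n - e m ∣ ⟩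
    ∣ x n - e m ∣            ≤⟨ x-e n L≤n m n<m ⟩
    B * inv n                ∎
    where open ℚ.≤-Reasoning

  approximates⇒limit : ∀ {x : Sequence} {e} → Approximates x e → ∀ ε → 0ℚ < ε →
    ∃[ M ] ∀ n .{{_ : NonZero n}} → M ℕ.≤ n → ∃[ δ ] 0ℚ < δ × ∃[ K ] ∀ m → K ℕ.≤ m → ∣ x n - e m ∣ + δ ≤ ε
  approximates⇒limit {x} {e} (B , 0≤B , L , x-e) ε 0<ε =
    -- One half of `ε` absorbs B/n once `n ≥ j`; the other is the uniform gap that `<ʳ` demands.
    let j , B≤jh = archimedean B h 0<h in
    j ℕ.⊔ L , λ n jL≤n → h , 0<h , suc n , λ m n<m → begin
      ∣ x n - e m ∣ + h   ≤⟨ ℚ.+-monoˡ-≤ h (x-e n (ℕ.m⊔n≤o⇒n≤o j L jL≤n) m n<m) ⟩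
      B * inv n + h       ≤⟨ ℚ.+-monoˡ-≤ h (ℚ.*-monoʳ-≤-nonNeg (inv n) {{nonNegative (0≤inv n)}} B≤jh) ⟩
      ι j * h * inv n + h ≡⟨ cong (_+ h) (solve 3 (λ i h v → i :* h :* v := i :* v :* h) refl (ι j) h (inv n)) ⟩
      ι j * inv n * h + h ≤⟨ ℚ.+-monoˡ-≤ h (ℚ.*-monoʳ-≤-nonNeg h {{nonNegative (ℚ.<⇒≤ 0<h)}} (ι*inv≤1 (ℕ.m⊔n≤o⇒m≤o j L jL≤n))) ⟩
      1ℚ * h + h          ≡⟨ cong (_+ h) (ℚ.*-identityˡ h) ⟩
      h + h               ≡⟨ ½+½ ε ⟩
      ε                   ∎
    where
    open ℚ.≤-Reasoning
    h = ½ * ε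
    0<h = ½-pos 0<ε

  -- The limit of the probability

  inv≤1 : ∀ m → inv (suc m) ≤ 1ℚ
  inv≤1 m = subst (_≤ 1ℚ) (ℚ.*-identityˡ (inv (suc m))) (ι*inv≤1 {1} {suc m} (s≤s z≤n))

  probability-product : ∀ c m n .{{_ : NonZero n}} → probability (suc c ℕ.* n) (suc m) n
    ≡ inv (suc m) * ((ρ (inv n) (suc m) ^ suc c) ^ n * (1ℚ - ((1ℚ - ι (suc m) * inv n) ^ suc c) ^ n))
  probability-product c m n@(suc n′) = ι-cancelˡ (suc m) (begin
    ι (suc m) * probability (suc c ℕ.* n) (suc m) n
      -- `suc c * n` computes to `suc (n′ + c * n)`, the positive tuple length that the formula
      -- expects.
      ≡⟨ probability-formula n (n′ ℕ.+ c ℕ.* n) m ⟩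
    ρ v (suc m) ^ (suc c ℕ.* n) * (1ℚ - (1ℚ - ι (suc m) * v) ^ (suc c ℕ.* n))
      ≡⟨ cong₂ (λ x y → x * (1ℚ - y)) (^-assocʳ (ρ v (suc m)) (suc c) n) (^-assocʳ (1ℚ - ι (suc m) * v) (suc c) n) ⟨
    Z
      ≡⟨ ℚ.*-identityˡ Z ⟨
    1ℚ * Z
      ≡⟨ cong (_* Z) (ι*inv (suc m)) ⟨
    ι (suc m) * inv (suc m) * Z
      ≡⟨ ℚ.*-assoc (ι (suc m)) (inv (suc m)) Z ⟩
    ι (suc m) * (inv (suc m) * Z) ∎)
    where
    open ≡-Reasoning
    v = inv n
    Z = (ρ v (suc m) ^ suc c) ^ n * (1ℚ - ((1ℚ - ι (suc m) * v) ^ suc c) ^ n)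

  module _ (c m : ℕ) where
    private
      a₁ = suc c ℕ.* (suc m C 2)
      a₂ = suc c ℕ.* suc m
      e₁ = sumBelow (expTerm (- ι a₁))
      e₂ = sumBelow (expTerm (- ι a₂))
      x y : Sequence
      x n = ρ (inv n) (suc m) ^ suc c
      y n = (1ℚ - ι (suc m) * inv n) ^ suc c

    approximates-probability :
      Approximates (λ n → probability (suc c ℕ.* n) (suc m) n) (λ l → inv (suc m) * e₁ l * (1ℚ - e₂ l))
    approximates-probability =
      let B , 0≤B , L , close = approximates-scale {x = λ n → x n ^ n * (1ℚ - y n ^ n)} {e = λ l → e₁ l * (1ℚ - e₂ l)}
            (0≤inv (suc m)) (inv≤1 m)
            (approximates-product {λ n → x n ^ n} {λ n → y n ^ n} {e₁} {e₂} {suc m} (cauchy (exp (- ι a₁)))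
              (approximates-exp {a₁} {_} {suc m} {x} x-expansion)
              (approximates-exp {a₂} {_} {suc m} {y} y-expansion)
              λ n m<n → let E = y-expansion n m<n in
                0≤^ (Expansion.nonNeg E) n , ^≤1 (Expansion.nonNeg E) (Expansion.≤1 E) n)
      in B , 0≤B , L , λ n L≤n l n<l → subst₂ (λ p z → ∣ p - z ∣ ≤ B * inv n)
        (sym (probability-product c m n)) (sym (ℚ.*-assoc (inv (suc m)) (e₁ l) (1ℚ - e₂ l))) (close n L≤n l n<l)
      where
      ρ-expansion = expansion-ρ (suc m)
      ρ^c-expansion = expansion-^ (suc m C 2) (proj₁ ρ-expansion) (suc c)
      linear^c-expansion = expansion-^ (suc m) 0 (suc c)
      x-expansion : ∀ n .{{_ : NonZero n}} → suc m ℕ.≤ n → Expansion (inv n) a₁ (proj₁ ρ^c-expansion) (x n)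
      x-expansion n m<n = proj₂ ρ^c-expansion (0≤inv n) (proj₂ ρ-expansion n m<n)
      y-expansion : ∀ n .{{_ : NonZero n}} → suc m ℕ.≤ n → Expansion (inv n) a₂ (proj₁ linear^c-expansion) (y n)
      y-expansion n m<n = proj₂ linear^c-expansion (0≤inv n) (expansion-linear m<n)

    probability-limit : ∀ ε → 0ℚ < ε → ∃[ M ] ∀ n .{{_ : NonZero n}} → M ℕ.≤ n →
      ∃[ δ ] 0ℚ < δ × ∃[ K ] ∀ l → K ℕ.≤ l →
        ∣ probability (suc c ℕ.* n) (suc m) n - inv (suc m) * e₁ l * (1ℚ - e₂ l) ∣ + δ ≤ ε
    probability-limit = approximates⇒limit {λ n → probability (suc c ℕ.* n) (suc m) n}
      {λ l → inv (suc m) * e₁ l * (1ℚ - e₂ l)} approximates-probability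

open import Data.Nat using (ℕ; suc; _*_; NonZero; >-nonZero)
open import Data.Nat.Properties using (m<n⇒0<n)
open import Data.Nat.Combinatorics using (_C_)
open import Data.Integer using (+_)
open import Data.Rational using (-_; _/_; 1ℚ)

corollary4p9 : (c N : ℕ) .{{_ : NonZero c}} .{{_ : NonZero N}} →
    Limit (suc N)
    (λ n N<n → fromℚ (probability (c * n) N n {{n≢0 = >-nonZero (m<n⇒0<n N<n)}}))
    (fromℚ (+ 1 / N) *ʳ exp (- ι (c * (N C 2))) *ʳ (fromℚ 1ℚ -ʳ exp (- ι (c * N))))
corollary4p9 (suc c) (suc m) ε 0<ε =
  -- The real operations act termwise, so `Limit` unfolds to the rational estimate already proved.
  let M , close = Asymptotics.probability-limit c m ε 0<ε in
  M , λ n N<n → close n {{>-nonZero (m<n⇒0<n N<n)}}
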